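{- Let $\gamma \geq 0$ be an integer. The operad $\mathsf{Dias}_\gamma$ admits the following presentation. It is generated by the set $\mathfrak{G} = \{\dashv_a, \vdash_a : a \in [\gamma]\}$ of binary generators, and its space of relations is the space induced by the equivalence relation $\leftrightarrow_\gamma$ satisfying $$\dashv_a \circ_1 \vdash_{a'} \;\leftrightarrow_\gamma\; \vdash_{a'} \circ_2 \dashv_a, \qquad a, a' \in [\gamma],$$ $$\dashv_a \circ_1 \dashv_b \;\leftrightarrow_\gamma\; \dashv_a \circ_2 \vdash_b, \qquad a < b \in [\gamma],$$ $$\vdash_a \circ_1 \dashv_b \;\leftrightarrow_\gamma\; \vdash_a \circ_2 \vdash_b, \qquad a < b \in [\gamma],$$ $$\dashv_b \circ_1 \dashv_a \;\leftrightarrow_\gamma\; \dashv_a \circ_2 \dashv_b, \qquad a < b \in [\gamma],$$ $$\vdash_a \circ_1 \vdash_b \;\leftrightarrow_\gamma\; \vdash_b \circ_2 \vdash_a, \qquad a < b \in [\gamma],$$ $$\dashv_d \circ_1 \dashv_d \;\leftrightarrow_\gamma\; \dashv_d \circ_2 \dashv_c \;\leftrightarrow_\gamma\; \dashv_d \circ_2 \vdash_c, \qquad c \leq d \in [\gamma],$$ $$\vdash_d \circ_1 \dashv_c \;\leftrightarrow_\gamma\; \vdash_d \circ_1 \vdash_c \;\leftrightarrow_\gamma\; \vdash_d \circ_2 \vdash_d, \qquad c \leq d \in [\gamma].$$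
   Context: The ground field $\mathbb{K}$ has characteristic zero; operad means nonsymmetric operad in $\mathbb{K}$-vector spaces; $[\gamma] = \{1, \dots, \gamma\}$. Definition of $\mathsf{Dias}_\gamma$: let $\mathcal{M}_\gamma$ be the monoid $\{0\} \cup [\gamma]$ with product $\max$. The operad $\mathsf{T}\mathcal{M}_\gamma$ has as component of arity $n \geq 1$ the linear span of the words of length $n$ on $\mathcal{M}_\gamma$, with partial compositions $u \circ_i v := u_1 \dots u_{i-1}\, \max(u_i, v_1) \dots \max(u_i, v_m)\, u_{i+1} \dots u_n$ (for $u$ of length $n$, $v$ of length $m$, $i \in [n]$) and unit the word $0$. $\mathsf{Dias}_\gamma$ is the suboperad of $\mathsf{T}\mathcal{M}_\gamma$ generated by the words $0a$ and $a0$, $a \in [\gamma]$. Presentations: for a set $\mathfrak{G}$ of generators of arity $2$, $\mathbf{Free}(\mathfrak{G})$ is the free operad, whose component of arity $n$ is spanned by the planar binary trees with $n$ leaves whose internal nodes are labeled by $\mathfrak{G}$, $\mathfrak{s} \circ_i \mathfrak{t}$ being the grafting of the root of $\mathfrak{t}$ on the $i$th leaf of $\mathfrak{s}$; for $x, y \in \mathfrak{G}$, $x \circ_i y$ denotes the corresponding tree with two internal nodes. An operad $\mathcal{O}$ admits the presentation $(\mathfrak{G}, \mathfrak{R})$, where $\mathfrak{R}$ is a subspace of $\mathbf{Free}(\mathfrak{G})$, if $\mathcal{O} \cong \mathbf{Free}(\mathfrak{G})/\langle \mathfrak{R} \rangle$, $\langle \mathfrak{R} \rangle$ being the operad ideal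 generated by $\mathfrak{R}$. The space induced by an equivalence relation $\leftrightarrow$ on trees is the subspace spanned by all $x - x'$ with $x \leftrightarrow x'$. -}

module Defs where

open import Algebra.Apartness.Bundles using (HeytingField; HeytingCommutativeRing)
open import Algebra.Bundles using (CommutativeRing)
import Algebra.Construct.NaturalChoice.Max as Max
open import Algebra.Module.Bundles using (LeftModule)
open import Algebra.Module.Morphism.Structures using (module LeftModuleMorphisms)
import Algebra.Properties.AbelianGroup as AbelianGroupProperties
import Algebra.Module.Properties.LeftModule as LeftModuleProperties
import Algebra.Properties.Monoid.Mult as Mult
open import Algebra.Structures using (IsMonoid)
open import Data.Fin.Base using (Fin; zero; suc; toℕ; _<_; _≤_)
import Data.Fin.Properties as Fin
open import Data.List.Base using (List)
import Data.List.Base as List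
import Data.List.Properties as List
open import Data.Nat.Base as ℕ using (ℕ; zero; suc; _+_; _∸_; z≤n; s≤s)
import Data.Nat.Properties as ℕ
open import Data.Product.Base using (Σ; Σ-syntax; ∃₂; _×_; _,_; proj₁; proj₂)
open import Data.Vec.Base using (Vec; []; _∷_; _++_; cast; map; toList)
import Data.Vec.Properties as Vec
open import Function.Base using (_∘_)
open import Level using (Level; _⊔_) renaming (suc to lsuc)
open import Relation.Binary.Core using (Rel)
open import Relation.Binary.Construct.Closure.Equivalence using (EqClosure)
open import Relation.Binary.PropositionalEquality
  using (_≡_; refl; sym; trans; cong; cong₂; subst; module ≡-Reasoning)
import Relation.Binary.Reasoning.Setoid as SetoidReasoning
open import Relation.Nullary.Decidable.Core using (yes; no)
open import Relation.Nullary.Negation.Core using (¬_; contradiction)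
open import Relation.Unary using (Pred)

-- Degree n stands for arity suc n throughout, as operads here have no
-- component of arity 0.  The composition of arities suc m and suc n then has
-- arity suc (m + n).  Positions are 0-based: x ∘⟨ i ⟩ y is x ∘ᵢ₊₁ y.

record SetOperad : Set₁ where
  infixl 7 _∘⟨_⟩_
  field
    Op     : ℕ → Set
    unit   : Op 0
    _∘⟨_⟩_ : ∀ {m n} → Op m → Fin (suc m) → Op n → Op (m + n)
    unitˡ  : ∀ {n} (x : Op n) → unit ∘⟨ zero ⟩ x ≡ x
    unitʳ  : ∀ {m} (x : Op m) i (e : m + 0 ≡ m) →
             subst Op e (x ∘⟨ i ⟩ unit) ≡ x
    seq    : ∀ {l m n} (x : Op l) (y : Op m) (z : Op n) i j k →
             toℕ k ≡ toℕ i + toℕ j → (e : l + m + n ≡ l + (m + n)) →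
             subst Op e ((x ∘⟨ i ⟩ y) ∘⟨ k ⟩ z) ≡ x ∘⟨ i ⟩ (y ∘⟨ j ⟩ z)
    par    : ∀ {l m n} (x : Op l) (y : Op m) (z : Op n) i k i′ k′ → i < k →
             toℕ i′ ≡ toℕ i → toℕ k′ ≡ toℕ k + m →
             (e : l + m + n ≡ l + n + m) →
             subst Op e ((x ∘⟨ i ⟩ y) ∘⟨ k′ ⟩ z) ≡ (x ∘⟨ k ⟩ z) ∘⟨ i′ ⟩ y

module _ {M : Set} {_∙_ : M → M → M} {ε : M} (isMonoid : IsMonoid _≡_ _∙_ ε) where
  open IsMonoid isMonoid using (assoc; identityˡ; identityʳ)

  -- u₁ … uᵢ₋₁ (uᵢ ∙ v₁) … (uᵢ ∙ vₘ) uᵢ₊₁ … uₙ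
  insert : ∀ {m n} → Vec M (suc m) → Fin (suc m) → Vec M (suc n) → Vec M (suc (m + n))
  insert {m}     {n} (a ∷ u) zero    v = cast (cong suc (ℕ.+-comm n m)) (map (a ∙_) v ++ u)
  insert {suc m}     (a ∷ u) (suc i) v = a ∷ insert u i v

  insertᴸ : List M → ℕ → List M → List M
  insertᴸ List.[]      _       v = List.[]
  insertᴸ (a List.∷ u) zero    v = List.map (a ∙_) v List.++ u
  insertᴸ (a List.∷ u) (suc i) v = a List.∷ insertᴸ u i v

  toList-insert : ∀ {m n} (u : Vec M (suc m)) i (v : Vec M (suc n)) →
                  toList (insert u i v) ≡ insertᴸ (toList u) (toℕ i) (toList v)
  toList-insert {m} {n} (a ∷ u) zero v =
    trans (Vec.toList-cast (cong suc (ℕ.+-comm n m)) (map (a ∙_) v ++ u))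
      (trans (Vec.toList-++ (map (a ∙_) v) u)
             (cong (List._++ toList u) (Vec.toList-map (a ∙_) v)))
  toList-insert {suc m} (a ∷ u) (suc i) v = cong (a List.∷_) (toList-insert u i v)

  vec≡ : ∀ {n} {u v : Vec M n} → toList u ≡ toList v → u ≡ v
  vec≡ {u = u} {v} p = trans (sym (Vec.cast-is-id refl u)) (Vec.toList-injective refl u v p)

  toList-subst : ∀ {m n} (e : m ≡ n) (u : Vec M (suc m)) →
                 toList (subst (Vec M ∘ suc) e u) ≡ toList u
  toList-subst refl u = refl

  insert-++ : ∀ xs u k w → insertᴸ (xs List.++ u) (k + List.length xs) w
                           ≡ xs List.++ insertᴸ u k w
  insert-++ List.[]       u k w = cong (λ k → insertᴸ u k w) (ℕ.+-identityʳ k)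
  insert-++ (x List.∷ xs) u k w rewrite ℕ.+-suc k (List.length xs) =
    cong (x List.∷_) (insert-++ xs u k w)

  insert-map : ∀ a u v j w → j ℕ.< List.length v →
               insertᴸ (List.map (a ∙_) v List.++ u) j w
               ≡ List.map (a ∙_) (insertᴸ v j w) List.++ u
  insert-map a u (b List.∷ v) zero w _ = begin
    List.map ((a ∙ b) ∙_) w List.++ (List.map (a ∙_) v List.++ u)
      ≡⟨ List.++-assoc (List.map ((a ∙ b) ∙_) w) _ u ⟨
    (List.map ((a ∙ b) ∙_) w List.++ List.map (a ∙_) v) List.++ u
      ≡⟨ cong (λ t → (t List.++ List.map (a ∙_) v) List.++ u)
           (trans (List.map-cong (assoc a b) w) (List.map-∘ w)) ⟩
    (List.map (a ∙_) (List.map (b ∙_) w) List.++ List.map (a ∙_) v) List.++ u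
      ≡⟨ cong (List._++ u) (List.map-++ (a ∙_) (List.map (b ∙_) w) v) ⟨
    List.map (a ∙_) (List.map (b ∙_) w List.++ v) List.++ u ∎
    where open ≡-Reasoning
  insert-map a u (b List.∷ v) (suc j) w (s≤s p) =
    cong ((a ∙ b) List.∷_) (insert-map a u v j w p)

  seqᴸ : ∀ u i v j w → i ℕ.< List.length u → j ℕ.< List.length v →
         insertᴸ (insertᴸ u i v) (i + j) w ≡ insertᴸ u i (insertᴸ v j w)
  seqᴸ (a List.∷ u) zero    v j w p       q = insert-map a u v j w q
  seqᴸ (a List.∷ u) (suc i) v j w (s≤s p) q = cong (a List.∷_) (seqᴸ u i v j w p q)

  parᴸ : ∀ u i k v w → i ℕ.≤ k →
         insertᴸ (insertᴸ u i v) (k + List.length v) w ≡ insertᴸ (insertᴸ u (suc k) w) i v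
  parᴸ List.[]      i       k v w p = refl
  parᴸ (a List.∷ u) zero    k v w p =
    trans (cong (λ t → insertᴸ (List.map (a ∙_) v List.++ u) (k + t) w)
                (sym (List.length-map (a ∙_) v)))
          (insert-++ (List.map (a ∙_) v) u k w)
  parᴸ (a List.∷ u) (suc i) (suc k) v w (s≤s p) = cong (a List.∷_) (parᴸ u i k v w p)

  unitʳᴸ : ∀ u i → insertᴸ u i List.[ ε ] ≡ u
  unitʳᴸ List.[]      i       = refl
  unitʳᴸ (a List.∷ u) zero    = cong (List._∷ u) (identityʳ a)
  unitʳᴸ (a List.∷ u) (suc i) = cong (a List.∷_) (unitʳᴸ u i)

  unitˡᴸ : ∀ u → List.map (ε ∙_) u List.++ List.[] ≡ u
  unitˡᴸ u = trans (List.++-identityʳ _) (trans (List.map-cong identityˡ u) (List.map-id u))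

  <-length : ∀ {n} (u : Vec M (suc n)) (i : Fin (suc n)) → toℕ i ℕ.< List.length (toList u)
  <-length u i = subst (toℕ i ℕ.<_) (sym (Vec.length-toList u)) (Fin.toℕ<n i)

  seqᵂ : ∀ {l m n} (u : Vec M (suc l)) (v : Vec M (suc m)) (w : Vec M (suc n)) i j k →
         toℕ k ≡ toℕ i + toℕ j → (e : l + m + n ≡ l + (m + n)) →
         subst (Vec M ∘ suc) e (insert (insert u i v) k w) ≡ insert u i (insert v j w)
  seqᵂ u v w i j k p e = vec≡ (begin
    toList (subst (Vec M ∘ suc) e (insert (insert u i v) k w))
      ≡⟨ toList-subst e (insert (insert u i v) k w) ⟩
    toList (insert (insert u i v) k w)
      ≡⟨ toList-insert (insert u i v) k w ⟩
    insertᴸ (toList (insert u i v)) (toℕ k) (toList w)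
      ≡⟨ cong₂ (λ t k → insertᴸ t k (toList w)) (toList-insert u i v) p ⟩
    insertᴸ (insertᴸ (toList u) (toℕ i) (toList v)) (toℕ i + toℕ j) (toList w)
      ≡⟨ seqᴸ (toList u) (toℕ i) (toList v) (toℕ j) (toList w) (<-length u i) (<-length v j) ⟩
    insertᴸ (toList u) (toℕ i) (insertᴸ (toList v) (toℕ j) (toList w))
      ≡⟨ cong (insertᴸ (toList u) (toℕ i)) (toList-insert v j w) ⟨
    insertᴸ (toList u) (toℕ i) (toList (insert v j w))
      ≡⟨ toList-insert u i (insert v j w) ⟨
    toList (insert u i (insert v j w)) ∎)
    where open ≡-Reasoning

  parᵂ : ∀ {l m n} (u : Vec M (suc l)) (v : Vec M (suc m)) (w : Vec M (suc n)) i k i′ k′ →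
         i < k → toℕ i′ ≡ toℕ i → toℕ k′ ≡ toℕ k + m → (e : l + m + n ≡ l + n + m) →
         subst (Vec M ∘ suc) e (insert (insert u i v) k′ w) ≡ insert (insert u k w) i′ v
  parᵂ {l} {m} u v w i (suc k) i′ k′ (s≤s i≤k) p q e = vec≡ (begin
    toList (subst (Vec M ∘ suc) e (insert (insert u i v) k′ w))
      ≡⟨ toList-subst e (insert (insert u i v) k′ w) ⟩
    toList (insert (insert u i v) k′ w)
      ≡⟨ toList-insert (insert u i v) k′ w ⟩
    insertᴸ (toList (insert u i v)) (toℕ k′) (toList w)
      ≡⟨ cong₂ (λ t k → insertᴸ t k (toList w)) (toList-insert u i v) q′ ⟩
    insertᴸ (insertᴸ (toList u) (toℕ i) (toList v)) (toℕ k + List.length (toList v)) (toList w)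
      ≡⟨ parᴸ (toList u) (toℕ i) (toℕ k) (toList v) (toList w) i≤k ⟩
    insertᴸ (insertᴸ (toList u) (suc (toℕ k)) (toList w)) (toℕ i) (toList v)
      ≡⟨ cong₂ (λ t k → insertᴸ t k (toList v)) (toList-insert u (suc k) w) p ⟨
    insertᴸ (toList (insert u (suc k) w)) (toℕ i′) (toList v)
      ≡⟨ toList-insert (insert u (suc k) w) i′ v ⟨
    toList (insert (insert u (suc k) w) i′ v) ∎)
    where
    open ≡-Reasoning
    q′ : toℕ k′ ≡ toℕ k + List.length (toList v)
    q′ = trans q (trans (sym (ℕ.+-suc (toℕ k) m))
                        (cong (toℕ k +_) (sym (Vec.length-toList v))))

  Words : SetOperad
  Words = record
    { Op     = λ n → Vec M (suc n)
    ; unit   = ε ∷ []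
    ; _∘⟨_⟩_ = insert
    ; unitˡ  = λ u → vec≡ (trans (toList-insert (ε ∷ []) zero u) (unitˡᴸ (toList u)))
    ; unitʳ  = λ u i e → vec≡ (trans (toList-subst e (insert u i (ε ∷ [])))
                                (trans (toList-insert u i (ε ∷ [])) (unitʳᴸ (toList u) (toℕ i))))
    ; seq    = seqᵂ
    ; par    = parᵂ
    }

data Tree (𝔊 : Set) : Set where
  leaf : Tree 𝔊
  node : 𝔊 → Tree 𝔊 → Tree 𝔊 → Tree 𝔊

module _ {𝔊 : Set} where

  -- A binary tree with n internal nodes has suc n leaves.
  nodes : Tree 𝔊 → ℕ
  nodes leaf         = 0
  nodes (node g l r) = suc (nodes l + nodes r)

  -- Leaves are numbered from 0, left to right; the value at an out-of-range
  -- leaf is irrelevant.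
  graft : Tree 𝔊 → ℕ → Tree 𝔊 → Tree 𝔊
  graft leaf         i s = s
  graft (node g l r) i s with i ℕ.≤? nodes l
  ... | yes _ = node g (graft l i s) r
  ... | no  _ = node g l (graft r (i ∸ suc (nodes l)) s)

  nodes-graft : ∀ t i s → nodes (graft t i s) ≡ nodes t + nodes s
  nodes-graft leaf         i s = refl
  nodes-graft (node g l r) i s with i ℕ.≤? nodes l
  ... | yes _ = cong suc (begin
    nodes (graft l i s) + nodes r   ≡⟨ cong (_+ nodes r) (nodes-graft l i s) ⟩
    (nodes l + nodes s) + nodes r   ≡⟨ ℕ.+-assoc (nodes l) _ _ ⟩
    nodes l + (nodes s + nodes r)   ≡⟨ cong (nodes l +_) (ℕ.+-comm (nodes s) _) ⟩
    nodes l + (nodes r + nodes s)   ≡⟨ ℕ.+-assoc (nodes l) _ _ ⟨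
    (nodes l + nodes r) + nodes s   ∎)
    where open ≡-Reasoning
  ... | no _ = cong suc (trans (cong (nodes l +_) (nodes-graft r _ s))
                               (sym (ℕ.+-assoc (nodes l) _ _)))

  graft-left : ∀ g l r i s → i ℕ.≤ nodes l → graft (node g l r) i s ≡ node g (graft l i s) r
  graft-left g l r i s p with i ℕ.≤? nodes l
  ... | yes _ = refl
  ... | no ¬p = contradiction p ¬p

  graft-right : ∀ g l r i s → nodes l ℕ.< i →
                graft (node g l r) i s ≡ node g l (graft r (i ∸ suc (nodes l)) s)
  graft-right g l r i s p with i ℕ.≤? nodes l
  ... | yes q = contradiction q (ℕ.<⇒≱ p)
  ... | no _  = refl

  ≤-graft : ∀ {i j} t k s → i ℕ.≤ nodes t → j ℕ.≤ nodes s → i + j ℕ.≤ nodes (graft t k s)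
  ≤-graft t k s p q = ℕ.≤-trans (ℕ.+-mono-≤ p q) (ℕ.≤-reflexive (sym (nodes-graft t k s)))

  ≤-graft′ : ∀ {i} t k s → i ℕ.≤ nodes t → i ℕ.≤ nodes (graft t k s)
  ≤-graft′ t k s p = ℕ.≤-trans p (ℕ.≤-trans (ℕ.m≤m+n _ (nodes s))
                                            (ℕ.≤-reflexive (sym (nodes-graft t k s))))

  ∸-bound : ∀ {i} a b → i ℕ.≤ suc (a + b) → i ∸ suc a ℕ.≤ b
  ∸-bound a b p = ℕ.≤-trans (ℕ.∸-monoˡ-≤ (suc a) p) (ℕ.≤-reflexive (ℕ.m+n∸m≡n (suc a) b))

  seqᵀ : ∀ t i s j r → i ℕ.≤ nodes t → j ℕ.≤ nodes s →
         graft (graft t i s) (i + j) r ≡ graft t i (graft s j r)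
  seqᵀ leaf         zero s j r p q = refl
  seqᵀ (node g a b) i    s j r p q with i ℕ.≤? nodes a
  ... | yes i≤a = trans (graft-left g (graft a i s) b (i + j) r (≤-graft a i s i≤a q))
                        (cong (λ t → node g t b) (seqᵀ a i s j r i≤a q))
  ... | no  i≰a = begin
    graft (node g a (graft b (i ∸ suc (nodes a)) s)) (i + j) r
      ≡⟨ graft-right g a _ (i + j) r (ℕ.≤-trans a<i (ℕ.m≤m+n i j)) ⟩
    node g a (graft (graft b (i ∸ suc (nodes a)) s) (i + j ∸ suc (nodes a)) r)
      ≡⟨ cong (λ k → node g a (graft (graft b (i ∸ suc (nodes a)) s) k r))
           (ℕ.+-∸-comm j a<i) ⟩
    node g a (graft (graft b (i ∸ suc (nodes a)) s) ((i ∸ suc (nodes a)) + j) r)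
      ≡⟨ cong (node g a) (seqᵀ b _ s j r (∸-bound (nodes a) (nodes b) p) q) ⟩
    node g a (graft b (i ∸ suc (nodes a)) (graft s j r)) ∎
    where
    open ≡-Reasoning
    a<i = ℕ.≰⇒> i≰a

  parᵀ : ∀ t i k s r → i ℕ.< k → k ℕ.≤ nodes t →
         graft (graft t i s) (k + nodes s) r ≡ graft (graft t k r) i s
  parᵀ leaf         i zero s r () z≤n
  parᵀ (node g a b) i k s r i<k p with i ℕ.≤? nodes a | k ℕ.≤? nodes a
  ... | yes i≤a | yes k≤a = begin
    graft (node g (graft a i s) b) (k + nodes s) r
      ≡⟨ graft-left g (graft a i s) b _ r (≤-graft a i s k≤a ℕ.≤-refl) ⟩
    node g (graft (graft a i s) (k + nodes s) r) b
      ≡⟨ cong (λ t → node g t b) (parᵀ a i k s r i<k k≤a) ⟩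
    node g (graft (graft a k r) i s) b
      ≡⟨ graft-left g (graft a k r) b i s (≤-graft′ a k r i≤a) ⟨
    graft (node g (graft a k r) b) i s ∎
    where open ≡-Reasoning
  ... | yes i≤a | no k≰a = begin
    graft (node g (graft a i s) b) (k + nodes s) r
      ≡⟨ graft-right g (graft a i s) b (k + nodes s) r
           (subst (ℕ._< k + nodes s) (sym (nodes-graft a i s))
             (ℕ.+-monoˡ-< (nodes s) (ℕ.≰⇒> k≰a))) ⟩
    node g (graft a i s) (graft b (k + nodes s ∸ suc (nodes (graft a i s))) r)
      ≡⟨ cong (λ j → node g (graft a i s) (graft b j r))
           (trans (cong (λ j → k + nodes s ∸ suc j) (nodes-graft a i s))
                  (trans (cong₂ _∸_ (ℕ.+-comm k (nodes s)) (ℕ.+-comm (suc (nodes a)) (nodes s)))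
                         (ℕ.[m+n]∸[m+o]≡n∸o (nodes s) k (suc (nodes a))))) ⟩
    node g (graft a i s) (graft b (k ∸ suc (nodes a)) r)
      ≡⟨ graft-left g a _ i s i≤a ⟨
    graft (node g a (graft b (k ∸ suc (nodes a)) r)) i s ∎
    where open ≡-Reasoning
  ... | no i≰a | yes k≤a = contradiction (ℕ.≤-trans (ℕ.<⇒≤ i<k) k≤a) i≰a
  ... | no i≰a | no k≰a = begin
    graft (node g a (graft b (i ∸ suc (nodes a)) s)) (k + nodes s) r
      ≡⟨ graft-right g a _ _ r (ℕ.≤-trans a<k (ℕ.m≤m+n k (nodes s))) ⟩
    node g a (graft (graft b (i ∸ suc (nodes a)) s) (k + nodes s ∸ suc (nodes a)) r)
      ≡⟨ cong (λ j → node g a (graft (graft b (i ∸ suc (nodes a)) s) j r))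
           (ℕ.+-∸-comm (nodes s) a<k) ⟩
    node g a (graft (graft b (i ∸ suc (nodes a)) s) (k ∸ suc (nodes a) + nodes s) r)
      ≡⟨ cong (node g a) (parᵀ b _ _ s r (ℕ.∸-monoˡ-< i<k a<i)
           (∸-bound (nodes a) (nodes b) p)) ⟩
    node g a (graft (graft b (k ∸ suc (nodes a)) r) (i ∸ suc (nodes a)) s)
      ≡⟨ graft-right g a _ i s a<i ⟨
    graft (node g a (graft b (k ∸ suc (nodes a)) r)) i s ∎
    where
    open ≡-Reasoning
    a<i = ℕ.≰⇒> i≰a
    a<k = ℕ.≰⇒> k≰a

  unitʳᵀ : ∀ t i → graft t i leaf ≡ t
  unitʳᵀ leaf         i = refl
  unitʳᵀ (node g a b) i with i ℕ.≤? nodes a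
  ... | yes _ = cong (λ t → node g t b) (unitʳᵀ a i)
  ... | no  _ = cong (node g a) (unitʳᵀ b _)

  corolla : 𝔊 → Σ[ t ∈ Tree 𝔊 ] nodes t ≡ 1
  corolla g = node g leaf leaf , refl

module _ (𝔊 : Set) where

  T : ℕ → Set
  T n = Σ[ t ∈ Tree 𝔊 ] nodes t ≡ n

  T≡ : ∀ {n} {t s : T n} → proj₁ t ≡ proj₁ s → t ≡ s
  T≡ {t = t , p} {.t , q} refl = cong (t ,_) (ℕ.≡-irrelevant p q)

  proj₁-subst : ∀ {m n} (e : m ≡ n) (t : T m) → proj₁ (subst T e t) ≡ proj₁ t
  proj₁-subst refl t = refl

  ≤-nodes : ∀ {n} (t : T n) (i : Fin (suc n)) → toℕ i ℕ.≤ nodes (proj₁ t)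
  ≤-nodes (t , refl) i = ℕ.s≤s⁻¹ (Fin.toℕ<n i)

  Trees : SetOperad
  Trees = record
    { Op     = T
    ; unit   = leaf , refl
    ; _∘⟨_⟩_ = λ { (t , p) i (s , q) →
                   graft t (toℕ i) s , trans (nodes-graft t (toℕ i) s) (cong₂ _+_ p q) }
    ; unitˡ  = λ t → T≡ refl
    ; unitʳ  = λ t i e → T≡ (trans (proj₁-subst e _) (unitʳᵀ (proj₁ t) (toℕ i)))
    ; seq    = λ { x y z i j k p e → T≡ (trans (proj₁-subst e _)
                 (trans (cong (λ k → graft (graft (proj₁ x) (toℕ i) (proj₁ y)) k (proj₁ z)) p)
                        (seqᵀ (proj₁ x) (toℕ i) (proj₁ y) (toℕ j) (proj₁ z)
                              (≤-nodes x i) (≤-nodes y j)))) }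
    ; par    = λ { x (y , refl) z i k i′ k′ i<k p q e → T≡ (trans (proj₁-subst e _)
                 (trans (cong (λ k → graft (graft (proj₁ x) (toℕ i) y) k (proj₁ z)) q)
                 (trans (parᵀ (proj₁ x) (toℕ i) (toℕ k) y (proj₁ z) i<k (≤-nodes x k))
                        (cong (λ i → graft (graft (proj₁ x) (toℕ k) (proj₁ z)) i y) (sym p))))) }
    }

CharacteristicZero : ∀ {c ℓ₁ ℓ₂} → HeytingField c ℓ₁ ℓ₂ → Set ℓ₁
CharacteristicZero 𝕂 = ∀ n → ¬ (suc n ⋆ 1# ≈ 0#)
  where
  open HeytingField 𝕂 using (_≈_; 0#; 1#; heytingCommutativeRing)
  open HeytingCommutativeRing heytingCommutativeRing using (commutativeRing)
  open Mult (CommutativeRing.+-monoid commutativeRing) using () renaming (_×_ to _⋆_)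

module LinearOperads {c ℓ} (𝕂 : CommutativeRing c ℓ) where
  private module 𝕂 = CommutativeRing 𝕂

  record Operad m ℓm : Set (c ⊔ ℓ ⊔ lsuc (m ⊔ ℓm)) where
    infixl 7 _∘⟨_⟩_
    field
      component : ℕ → LeftModule 𝕂.ring m ℓm
    module C {n} = LeftModule (component n)
    open C using (_≈ᴹ_; _+ᴹ_; _*ₗ_)
    Op : ℕ → Set m
    Op n = LeftModule.Carrierᴹ (component n)
    field
      unit   : Op 0
      _∘⟨_⟩_ : ∀ {m n} → Op m → Fin (suc m) → Op n → Op (m + n)
      ∘-cong : ∀ {m n} {x x′ : Op m} i {y y′ : Op n} →
               x ≈ᴹ x′ → y ≈ᴹ y′ → x ∘⟨ i ⟩ y ≈ᴹ x′ ∘⟨ i ⟩ y′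
      +-∘    : ∀ {m n} (x x′ : Op m) i (y : Op n) →
               (x +ᴹ x′) ∘⟨ i ⟩ y ≈ᴹ x ∘⟨ i ⟩ y +ᴹ x′ ∘⟨ i ⟩ y
      *-∘    : ∀ {m n} k (x : Op m) i (y : Op n) →
               (k *ₗ x) ∘⟨ i ⟩ y ≈ᴹ k *ₗ (x ∘⟨ i ⟩ y)
      ∘-+    : ∀ {m n} (x : Op m) i (y y′ : Op n) →
               x ∘⟨ i ⟩ (y +ᴹ y′) ≈ᴹ x ∘⟨ i ⟩ y +ᴹ x ∘⟨ i ⟩ y′
      ∘-*    : ∀ {m n} k (x : Op m) i (y : Op n) →
               x ∘⟨ i ⟩ (k *ₗ y) ≈ᴹ k *ₗ (x ∘⟨ i ⟩ y)
      unitˡ  : ∀ {n} (x : Op n) → unit ∘⟨ zero ⟩ x ≈ᴹ x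
      unitʳ  : ∀ {m} (x : Op m) i (e : m + 0 ≡ m) →
               subst Op e (x ∘⟨ i ⟩ unit) ≈ᴹ x
      seq    : ∀ {l m n} (x : Op l) (y : Op m) (z : Op n) i j k →
               toℕ k ≡ toℕ i + toℕ j → (e : l + m + n ≡ l + (m + n)) →
               subst Op e ((x ∘⟨ i ⟩ y) ∘⟨ k ⟩ z) ≈ᴹ x ∘⟨ i ⟩ (y ∘⟨ j ⟩ z)
      par    : ∀ {l m n} (x : Op l) (y : Op m) (z : Op n) i k i′ k′ → i < k →
               toℕ i′ ≡ toℕ i → toℕ k′ ≡ toℕ k + m →
               (e : l + m + n ≡ l + n + m) →
               subst Op e ((x ∘⟨ i ⟩ y) ∘⟨ k′ ⟩ z) ≈ᴹ (x ∘⟨ k ⟩ z) ∘⟨ i′ ⟩ y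

  record _≅_ {m ℓm m′ ℓm′} (𝒪 : Operad m ℓm) (𝒫 : Operad m′ ℓm′) :
             Set (c ⊔ m ⊔ ℓm ⊔ m′ ⊔ ℓm′) where
    private
      module 𝒪 = Operad 𝒪
      module 𝒫 = Operad 𝒫
    field
      ⟦_⟧ : ∀ {n} → 𝒪.Op n → 𝒫.Op n
      isLeftModuleIsomorphism :
        ∀ n → LeftModuleMorphisms.IsLeftModuleIsomorphism
                (LeftModule.rawLeftModule (𝒪.component n))
                (LeftModule.rawLeftModule (𝒫.component n)) ⟦_⟧
      unit-homo : LeftModule._≈ᴹ_ (𝒫.component 0) ⟦ 𝒪.unit ⟧ 𝒫.unit
      ∘-homo : ∀ {m n} (x : 𝒪.Op m) i (y : 𝒪.Op n) →
               LeftModule._≈ᴹ_ (𝒫.component (m + n))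
                 ⟦ x 𝒪.∘⟨ i ⟩ y ⟧ (⟦ x ⟧ 𝒫.∘⟨ i ⟩ ⟦ y ⟧)

  -- Lin X with _≋_ is the vector space with basis X: formal linear combinations
  -- modulo the congruence generated by the vector space axioms.

  infixl 6 _⊕_
  infixr 7 _·_
  infix  4 _≋_

  data Lin (X : Set) : Set c where
    ⟨_⟩ : X → Lin X
    𝟎   : Lin X
    _⊕_ : Lin X → Lin X → Lin X
    _·_ : 𝕂.Carrier → Lin X → Lin X

  data _≋_ {X : Set} : Lin X → Lin X → Set (c ⊔ ℓ) where
    ≋-refl     : ∀ {x} → x ≋ x
    ≋-sym      : ∀ {x y} → x ≋ y → y ≋ x
    ≋-trans    : ∀ {x y z} → x ≋ y → y ≋ z → x ≋ z
    ⊕-cong     : ∀ {x x′ y y′} → x ≋ x′ → y ≋ y′ → x ⊕ y ≋ x′ ⊕ y′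
    ·-cong     : ∀ {k k′ x x′} → k 𝕂.≈ k′ → x ≋ x′ → k · x ≋ k′ · x′
    ⊕-assoc    : ∀ x y z → (x ⊕ y) ⊕ z ≋ x ⊕ (y ⊕ z)
    ⊕-comm     : ∀ x y → x ⊕ y ≋ y ⊕ x
    ⊕-identity : ∀ x → 𝟎 ⊕ x ≋ x
    ·-distribˡ : ∀ k x y → k · (x ⊕ y) ≋ k · x ⊕ k · y
    ·-distribʳ : ∀ k k′ x → (k 𝕂.+ k′) · x ≋ k · x ⊕ k′ · x
    ·-assoc    : ∀ k k′ x → (k 𝕂.* k′) · x ≋ k · (k′ · x)
    ·-identity : ∀ x → 𝕂.1# · x ≋ x
    ·-zero     : ∀ x → 𝕂.0# · x ≋ 𝟎

  ·-zeroʳ : ∀ {X} k → k · 𝟎 {X} ≋ 𝟎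
  ·-zeroʳ k = ≋-trans (·-cong 𝕂.refl (≋-sym (·-zero 𝟎)))
    (≋-trans (≋-sym (·-assoc k 𝕂.0# 𝟎)) (≋-trans (·-cong (𝕂.zeroʳ k) ≋-refl) (·-zero 𝟎)))

  ⊖_ : ∀ {X} → Lin X → Lin X
  ⊖ x = (𝕂.- 𝕂.1#) · x

  ⊖-inverseʳ : ∀ {X} (x : Lin X) → x ⊕ ⊖ x ≋ 𝟎
  ⊖-inverseʳ x = ≋-trans (⊕-cong (≋-sym (·-identity x)) ≋-refl)
    (≋-trans (≋-sym (·-distribʳ 𝕂.1# (𝕂.- 𝕂.1#) x))
      (≋-trans (·-cong (𝕂.-‿inverseʳ 𝕂.1#) ≋-refl) (·-zero x)))

  Free : Set → LeftModule 𝕂.ring c (c ⊔ ℓ)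
  Free X = record
    { Carrierᴹ = Lin X
    ; _≈ᴹ_     = _≋_
    ; _+ᴹ_     = _⊕_
    ; _*ₗ_     = _·_
    ; 0ᴹ       = 𝟎
    ; -ᴹ_      = ⊖_
    ; isLeftModule = record
      { isLeftSemimodule = record
        { +ᴹ-isCommutativeMonoid = record
          { isMonoid = record
            { isSemigroup = record
              { isMagma = record
                { isEquivalence = record { refl = ≋-refl ; sym = ≋-sym ; trans = ≋-trans }
                ; ∙-cong = ⊕-cong
                }
              ; assoc = ⊕-assoc
              }
            ; identity = ⊕-identity , λ x → ≋-trans (⊕-comm x 𝟎) (⊕-identity x)
            }
          ; comm = ⊕-comm
          }
        ; isPreleftSemimodule = record
          { *ₗ-cong      = ·-cong
          ; *ₗ-zeroˡ     = ·-zero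
          ; *ₗ-distribʳ  = λ x k k′ → ·-distribʳ k k′ x
          ; *ₗ-identityˡ = ·-identity
          ; *ₗ-assoc     = ·-assoc
          ; *ₗ-zeroʳ     = ·-zeroʳ
          ; *ₗ-distribˡ  = ·-distribˡ
          }
        }
      ; -ᴹ‿cong    = ·-cong 𝕂.refl
      ; -ᴹ‿inverse = (λ x → ≋-trans (⊕-comm (⊖ x) x) (⊖-inverseʳ x)) , ⊖-inverseʳ
      }
    }

  extend : ∀ {X Y} → (X → Lin Y) → Lin X → Lin Y
  extend f ⟨ a ⟩   = f a
  extend f 𝟎       = 𝟎
  extend f (x ⊕ y) = extend f x ⊕ extend f y
  extend f (k · x) = k · extend f x

  extend-cong : ∀ {X Y} (f : X → Lin Y) {x y} → x ≋ y → extend f x ≋ extend f y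
  extend-cong f ≋-refl              = ≋-refl
  extend-cong f (≋-sym p)           = ≋-sym (extend-cong f p)
  extend-cong f (≋-trans p q)       = ≋-trans (extend-cong f p) (extend-cong f q)
  extend-cong f (⊕-cong p q)        = ⊕-cong (extend-cong f p) (extend-cong f q)
  extend-cong f (·-cong e p)        = ·-cong e (extend-cong f p)
  extend-cong f (⊕-assoc x y z)     = ⊕-assoc _ _ _
  extend-cong f (⊕-comm x y)        = ⊕-comm _ _
  extend-cong f (⊕-identity x)      = ⊕-identity _
  extend-cong f (·-distribˡ k x y)  = ·-distribˡ k _ _
  extend-cong f (·-distribʳ k k′ x) = ·-distribʳ k k′ _
  extend-cong f (·-assoc k k′ x)    = ·-assoc k k′ _
  extend-cong f (·-identity x)      = ·-identity _
  extend-cong f (·-zero x)          = ·-zero _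

  extend-ext : ∀ {X Y} {f g : X → Lin Y} → (∀ a → f a ≋ g a) → ∀ x → extend f x ≋ extend g x
  extend-ext p ⟨ a ⟩   = p a
  extend-ext p 𝟎       = ≋-refl
  extend-ext p (x ⊕ y) = ⊕-cong (extend-ext p x) (extend-ext p y)
  extend-ext p (k · x) = ·-cong 𝕂.refl (extend-ext p x)

  extend₂ : ∀ {X Y Z} → (X → Y → Z) → Lin X → Lin Y → Lin Z
  extend₂ f x y = extend (λ a → extend (λ b → ⟨ f a b ⟩) y) x

  record IsLinear {X Y} (f : Lin X → Lin Y) : Set (c ⊔ ℓ) where
    constructor linear
    field
      f-𝟎 : f 𝟎 ≋ 𝟎
      f-⊕ : ∀ x y → f (x ⊕ y) ≋ f x ⊕ f y
      f-· : ∀ k x → f (k · x) ≋ k · f x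

  open IsLinear

  linear-ext : ∀ {X Y} {f g : Lin X → Lin Y} → IsLinear f → IsLinear g →
               (∀ a → f ⟨ a ⟩ ≋ g ⟨ a ⟩) → ∀ x → f x ≋ g x
  linear-ext F G p ⟨ a ⟩   = p a
  linear-ext F G p 𝟎       = ≋-trans (f-𝟎 F) (≋-sym (f-𝟎 G))
  linear-ext F G p (x ⊕ y) = ≋-trans (f-⊕ F x y)
    (≋-trans (⊕-cong (linear-ext F G p x) (linear-ext F G p y)) (≋-sym (f-⊕ G x y)))
  linear-ext F G p (k · x) = ≋-trans (f-· F k x)
    (≋-trans (·-cong 𝕂.refl (linear-ext F G p x)) (≋-sym (f-· G k x)))

  extend-linear : ∀ {X Y} (f : X → Lin Y) → IsLinear (extend f)
  extend-linear f = linear ≋-refl (λ x y → ≋-refl) (λ k x → ≋-refl)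

  id-linear : ∀ {X} → IsLinear {X} (λ x → x)
  id-linear = linear ≋-refl (λ x y → ≋-refl) (λ k x → ≋-refl)

  ∘-linear : ∀ {X Y Z} {f : Lin Y → Lin Z} {g : Lin X → Lin Y} →
             (∀ {x y} → x ≋ y → f x ≋ f y) → IsLinear f → IsLinear g → IsLinear (f ∘ g)
  ∘-linear c F G = linear (≋-trans (c (f-𝟎 G)) (f-𝟎 F))
    (λ x y → ≋-trans (c (f-⊕ G x y)) (f-⊕ F _ _)) (λ k x → ≋-trans (c (f-· G k x)) (f-· F k _))

  ⊕-interchange : ∀ {X} (x y z w : Lin X) → (x ⊕ y) ⊕ (z ⊕ w) ≋ (x ⊕ z) ⊕ (y ⊕ w)
  ⊕-interchange x y z w = ≋-trans (⊕-assoc x y _) (≋-trans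
    (⊕-cong ≋-refl (≋-trans (≋-sym (⊕-assoc y z w))
      (≋-trans (⊕-cong (⊕-comm y z) ≋-refl) (⊕-assoc z y w)))) (≋-sym (⊕-assoc x z _)))

  module _ {X Y Z : Set} (f : X → Y → Z) where

    extend₂-linearˡ : ∀ y → IsLinear (λ x → extend₂ f x y)
    extend₂-linearˡ y = extend-linear _

    extend₂-linearʳ : ∀ x → IsLinear (extend₂ f x)
    extend₂-linearʳ ⟨ a ⟩   = extend-linear _
    extend₂-linearʳ 𝟎       = linear ≋-refl (λ x y → ≋-sym (⊕-identity 𝟎)) (λ k x → ≋-sym (·-zeroʳ k))
    extend₂-linearʳ (x ⊕ y) = linear
      (≋-trans (⊕-cong (f-𝟎 F) (f-𝟎 G)) (⊕-identity 𝟎))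
      (λ z w → ≋-trans (⊕-cong (f-⊕ F z w) (f-⊕ G z w)) (⊕-interchange _ _ _ _))
      (λ k z → ≋-trans (⊕-cong (f-· F k z) (f-· G k z)) (≋-sym (·-distribˡ k _ _)))
      where
      F = extend₂-linearʳ x
      G = extend₂-linearʳ y
    extend₂-linearʳ (k · x) = linear
      (≋-trans (·-cong 𝕂.refl (f-𝟎 F)) (·-zeroʳ k))
      (λ z w → ≋-trans (·-cong 𝕂.refl (f-⊕ F z w)) (·-distribˡ k _ _))
      (λ k′ z → ≋-trans (·-cong 𝕂.refl (f-· F k′ z)) (≋-trans (≋-sym (·-assoc k k′ _))
        (≋-trans (·-cong (𝕂.*-comm k k′) ≋-refl) (·-assoc k′ k _))))
      where F = extend₂-linearʳ x

    extend₂-cong : ∀ {x x′ y y′} → x ≋ x′ → y ≋ y′ → extend₂ f x y ≋ extend₂ f x′ y′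
    extend₂-cong {x′ = x′} p q =
      ≋-trans (extend-cong _ p) (extend-ext (λ a → extend-cong _ q) x′)

  module _ (S : SetOperad) where
    private module S = SetOperad S

    L : ℕ → Set c
    L n = Lin (S.Op n)

    compose : ∀ {m n} → L m → Fin (suc m) → L n → L (m + n)
    compose x i y = extend₂ (λ a b → a S.∘⟨ i ⟩ b) x y

    subst-⟨⟩ : ∀ {m n} (e : m ≡ n) a → subst L e ⟨ a ⟩ ≡ ⟨ subst S.Op e a ⟩
    subst-⟨⟩ refl a = refl

    subst-linear : ∀ {m n} (e : m ≡ n) → IsLinear (subst L e)
    subst-linear refl = id-linear

    subst-cong : ∀ {m n} (e : m ≡ n) {x y : L m} → x ≋ y → subst L e x ≋ subst L e y
    subst-cong refl p = p

    linearˡ : ∀ {m n} i (y : L n) → IsLinear (λ (x : L m) → compose x i y)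
    linearˡ i y = extend₂-linearˡ _ y

    linearʳ : ∀ {m n} (x : L m) i → IsLinear (λ (y : L n) → compose x i y)
    linearʳ x i = extend₂-linearʳ _ x

    comp-cong : ∀ {m n} {x x′ : L m} i {y y′ : L n} →
                x ≋ x′ → y ≋ y′ → compose x i y ≋ compose x′ i y′
    comp-cong i p q = extend₂-cong _ p q

    comp-congˡ : ∀ {m n} i (y : L n) {x x′ : L m} → x ≋ x′ → compose x i y ≋ compose x′ i y
    comp-congˡ i y p = comp-cong i {y = y} p ≋-refl

    comp-congʳ : ∀ {m n} (x : L m) i {y y′ : L n} → y ≋ y′ → compose x i y ≋ compose x i y′
    comp-congʳ x i q = comp-cong {x = x} i ≋-refl q

    ≡⇒≋ : ∀ {X} {x y : Lin X} → x ≡ y → x ≋ y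
    ≡⇒≋ refl = ≋-refl

    comp-unitˡ : ∀ {n} (x : L n) → compose ⟨ S.unit ⟩ zero x ≋ x
    comp-unitˡ = linear-ext (linearʳ ⟨ S.unit ⟩ zero) id-linear
      (λ a → ≡⇒≋ (cong ⟨_⟩ (S.unitˡ a)))

    comp-unitʳ : ∀ {m} (x : L m) i (e : m + 0 ≡ m) → subst L e (compose x i ⟨ S.unit ⟩) ≋ x
    comp-unitʳ x i e = linear-ext
      (∘-linear (subst-cong e) (subst-linear e) (linearˡ i ⟨ S.unit ⟩))
      id-linear
      (λ a → ≡⇒≋ (trans (subst-⟨⟩ e _) (cong ⟨_⟩ (S.unitʳ a i e)))) x

    comp-seq : ∀ {l m n} (x : L l) (y : L m) (z : L n) i j k →
               toℕ k ≡ toℕ i + toℕ j → (e : l + m + n ≡ l + (m + n)) →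
               subst L e (compose (compose x i y) k z) ≋ compose x i (compose y j z)
    comp-seq x y z i j k p e = linear-ext
      (∘-linear (subst-cong e) (subst-linear e)
        (∘-linear (comp-congˡ k z) (linearˡ k z) (linearˡ i y)))
      (linearˡ i (compose y j z))
      (λ a → linear-ext
        (∘-linear (subst-cong e) (subst-linear e)
          (∘-linear (comp-congˡ k z) (linearˡ k z) (linearʳ ⟨ a ⟩ i)))
        (∘-linear (comp-congʳ ⟨ a ⟩ i) (linearʳ ⟨ a ⟩ i) (linearˡ j z))
        (λ b → linear-ext
          (∘-linear (subst-cong e) (subst-linear e) (linearʳ (compose ⟨ a ⟩ i ⟨ b ⟩) k))
          (∘-linear (comp-congʳ ⟨ a ⟩ i) (linearʳ ⟨ a ⟩ i) (linearʳ ⟨ b ⟩ j))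
          (λ c → ≡⇒≋ (trans (subst-⟨⟩ e _) (cong ⟨_⟩ (S.seq a b c i j k p e)))) z) y) x

    comp-par : ∀ {l m n} (x : L l) (y : L m) (z : L n) i k i′ k′ → i < k →
               toℕ i′ ≡ toℕ i → toℕ k′ ≡ toℕ k + m → (e : l + m + n ≡ l + n + m) →
               subst L e (compose (compose x i y) k′ z) ≋ compose (compose x k z) i′ y
    comp-par x y z i k i′ k′ i<k p q e = linear-ext
      (∘-linear (subst-cong e) (subst-linear e)
        (∘-linear (comp-congˡ k′ z) (linearˡ k′ z) (linearˡ i y)))
      (∘-linear (comp-congˡ i′ y) (linearˡ i′ y) (linearˡ k z))
      (λ a → linear-ext
        (∘-linear (subst-cong e) (subst-linear e)
          (∘-linear (comp-congˡ k′ z) (linearˡ k′ z) (linearʳ ⟨ a ⟩ i)))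
        (linearʳ (compose ⟨ a ⟩ k z) i′)
        (λ b → linear-ext
          (∘-linear (subst-cong e) (subst-linear e) (linearʳ (compose ⟨ a ⟩ i ⟨ b ⟩) k′))
          (∘-linear (comp-congˡ i′ ⟨ b ⟩) (linearˡ i′ ⟨ b ⟩) (linearʳ ⟨ a ⟩ k))
          (λ c → ≡⇒≋ (trans (subst-⟨⟩ e _) (cong ⟨_⟩ (S.par a b c i k i′ k′ i<k p q e)))) z) y) x

    Linearization : Operad c (c ⊔ ℓ)
    Linearization = record
      { component = λ n → Free (S.Op n)
      ; unit      = ⟨ S.unit ⟩
      ; _∘⟨_⟩_    = compose
      ; ∘-cong    = comp-cong
      ; +-∘       = λ x x′ i y → ≋-refl
      ; *-∘       = λ k x i y → ≋-refl
      ; ∘-+       = λ x i → f-⊕ (linearʳ x i)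
      ; ∘-*       = λ k x i → f-· (linearʳ x i) k
      ; unitˡ     = comp-unitˡ
      ; unitʳ     = comp-unitʳ
      ; seq       = comp-seq
      ; par       = comp-par
      }

  module _ {m ℓm} (𝒪 : Operad m ℓm) where
    open Operad 𝒪
    open C

    data Generated {g} (G : ∀ n → Pred (Op n) g) : ∀ n → Pred (Op n) (c ⊔ m ⊔ ℓm ⊔ g) where
      gen   : ∀ {n x} → G n x → Generated G n x
      resp  : ∀ {n x y} → x ≈ᴹ y → Generated G n x → Generated G n y
      zero  : ∀ {n} → Generated G n 0ᴹ
      add   : ∀ {n x y} → Generated G n x → Generated G n y → Generated G n (x +ᴹ y)
      scale : ∀ {n x} k → Generated G n x → Generated G n (k *ₗ x)
      one   : Generated G 0 unit
      comp  : ∀ {m n x y} i → Generated G m x → Generated G n y → Generated G (m + n) (x ∘⟨ i ⟩ y)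

    data Ideal {r} (R : ∀ n → Pred (Op n) r) : ∀ n → Pred (Op n) (c ⊔ m ⊔ ℓm ⊔ r) where
      gen   : ∀ {n x} → R n x → Ideal R n x
      resp  : ∀ {n x y} → x ≈ᴹ y → Ideal R n x → Ideal R n y
      zero  : ∀ {n} → Ideal R n 0ᴹ
      add   : ∀ {n x y} → Ideal R n x → Ideal R n y → Ideal R n (x +ᴹ y)
      scale : ∀ {n x} k → Ideal R n x → Ideal R n (k *ₗ x)
      compˡ : ∀ {m n x} i (y : Op n) → Ideal R m x → Ideal R (m + n) (x ∘⟨ i ⟩ y)
      compʳ : ∀ {m n y} (x : Op m) i → Ideal R n y → Ideal R (m + n) (x ∘⟨ i ⟩ y)

    neg≈ : ∀ {n} (x : Op n) → (𝕂.- 𝕂.1#) *ₗ x ≈ᴹ -ᴹ x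
    neg≈ {n} x = inverseʳ-uniqueᴹ x _ (≈ᴹ-trans (+ᴹ-cong (≈ᴹ-sym (*ₗ-identityˡ x)) ≈ᴹ-refl)
      (≈ᴹ-trans (≈ᴹ-sym (*ₗ-distribʳ x 𝕂.1# (𝕂.- 𝕂.1#)))
        (≈ᴹ-trans (*ₗ-cong (𝕂.-‿inverseʳ 𝕂.1#) ≈ᴹ-refl) (*ₗ-zeroˡ x))))
      where open LeftModuleProperties (component n) using (inverseʳ-uniqueᴹ)

    module _ {g} (G : ∀ n → Pred (Op n) g) where

      Sub : ℕ → Set (c ⊔ m ⊔ ℓm ⊔ g)
      Sub n = Σ[ x ∈ Op n ] Generated G n x

      subst-≈ : ∀ {m n} (e : m ≡ n) (x : Sub m) {y : Op n} →
                subst Op e (proj₁ x) ≈ᴹ y → proj₁ (subst Sub e x) ≈ᴹ y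
      subst-≈ refl x p = p

      suboperadComponent : ∀ n → LeftModule 𝕂.ring (c ⊔ m ⊔ ℓm ⊔ g) ℓm
      suboperadComponent n = record
        { Carrierᴹ = Sub n
        ; _≈ᴹ_     = λ x y → proj₁ x ≈ᴹ proj₁ y
        ; _+ᴹ_     = λ { (x , p) (y , q) → x +ᴹ y , add p q }
        ; _*ₗ_     = λ { k (x , p) → k *ₗ x , scale k p }
        ; 0ᴹ       = 0ᴹ , zero
        ; -ᴹ_      = λ { (x , p) → -ᴹ x , resp (neg≈ x) (scale (𝕂.- 𝕂.1#) p) }
        ; isLeftModule = record
          { isLeftSemimodule = record
            { +ᴹ-isCommutativeMonoid = record
              { isMonoid = record
                { isSemigroup = record
                  { isMagma = record
                    { isEquivalence = record { refl = ≈ᴹ-refl ; sym = ≈ᴹ-sym ; trans = ≈ᴹ-trans }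
                    ; ∙-cong = +ᴹ-cong
                    }
                  ; assoc = λ _ _ _ → +ᴹ-assoc _ _ _
                  }
                ; identity = (λ _ → +ᴹ-identityˡ _) , (λ _ → +ᴹ-identityʳ _)
                }
              ; comm = λ _ _ → +ᴹ-comm _ _
              }
            ; isPreleftSemimodule = record
              { *ₗ-cong      = *ₗ-cong
              ; *ₗ-zeroˡ     = λ _ → *ₗ-zeroˡ _
              ; *ₗ-distribʳ  = λ _ _ _ → *ₗ-distribʳ _ _ _
              ; *ₗ-identityˡ = λ _ → *ₗ-identityˡ _
              ; *ₗ-assoc     = λ _ _ _ → *ₗ-assoc _ _ _
              ; *ₗ-zeroʳ     = λ _ → *ₗ-zeroʳ _
              ; *ₗ-distribˡ  = λ _ _ _ → *ₗ-distribˡ _ _ _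
              }
            }
          ; -ᴹ‿cong    = -ᴹ‿cong
          ; -ᴹ‿inverse = (λ _ → -ᴹ‿inverseˡ _) , (λ _ → -ᴹ‿inverseʳ _)
          }
        }

      suboperad : Operad (c ⊔ m ⊔ ℓm ⊔ g) ℓm
      suboperad = record
        { component = suboperadComponent
        ; unit      = unit , one
        ; _∘⟨_⟩_    = λ { (x , p) i (y , q) → x ∘⟨ i ⟩ y , comp i p q }
        ; ∘-cong    = λ i p q → ∘-cong i p q
        ; +-∘       = λ _ _ i _ → +-∘ _ _ i _
        ; *-∘       = λ k _ i _ → *-∘ k _ i _
        ; ∘-+       = λ _ i _ _ → ∘-+ _ i _ _
        ; ∘-*       = λ k _ i _ → ∘-* k _ i _
        ; unitˡ     = λ _ → unitˡ _
        ; unitʳ     = λ x i e → subst-≈ e _ (unitʳ (proj₁ x) i e)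
        ; seq       = λ x y z i j k p e →
                        subst-≈ e _ (seq (proj₁ x) (proj₁ y) (proj₁ z) i j k p e)
        ; par       = λ x y z i k i′ k′ i<k p q e →
                        subst-≈ e _ (par (proj₁ x) (proj₁ y) (proj₁ z) i k i′ k′ i<k p q e)
        }

    module _ {r} (R : ∀ n → Pred (Op n) r) where

      infix 4 _~_
      _~_ : ∀ {n} → Op n → Op n → Set (c ⊔ m ⊔ ℓm ⊔ r)
      _~_ {n} x y = Ideal R n (x +ᴹ -ᴹ y)

      module _ {n : ℕ} where
        open LeftModuleProperties (component n) using (inverseʳ-uniqueᴹ)
        open AbelianGroupProperties (+ᴹ-abelianGroup {n})
          using (⁻¹-anti-homo‿-; ⁻¹-∙-comm; x≈y⇒x∙y⁻¹≈ε)
        open SetoidReasoning (≈ᴹ-setoid {n})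

        tele : ∀ (x y z : Op n) → (x +ᴹ -ᴹ y) +ᴹ (y +ᴹ -ᴹ z) ≈ᴹ x +ᴹ -ᴹ z
        tele x y z = begin
          (x +ᴹ -ᴹ y) +ᴹ (y +ᴹ -ᴹ z) ≈⟨ +ᴹ-assoc x _ _ ⟩
          x +ᴹ (-ᴹ y +ᴹ (y +ᴹ -ᴹ z)) ≈⟨ +ᴹ-congˡ (≈ᴹ-sym (+ᴹ-assoc _ y _)) ⟩
          x +ᴹ ((-ᴹ y +ᴹ y) +ᴹ -ᴹ z) ≈⟨ +ᴹ-congˡ (+ᴹ-congʳ (-ᴹ‿inverseˡ y)) ⟩
          x +ᴹ (0ᴹ +ᴹ -ᴹ z)          ≈⟨ +ᴹ-congˡ (+ᴹ-identityˡ _) ⟩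
          x +ᴹ -ᴹ z                  ∎

        interchange : ∀ (x y z w : Op n) → (x +ᴹ y) +ᴹ (z +ᴹ w) ≈ᴹ (x +ᴹ z) +ᴹ (y +ᴹ w)
        interchange x y z w = begin
          (x +ᴹ y) +ᴹ (z +ᴹ w) ≈⟨ +ᴹ-assoc x y _ ⟩
          x +ᴹ (y +ᴹ (z +ᴹ w)) ≈⟨ +ᴹ-congˡ (≈ᴹ-sym (+ᴹ-assoc y z w)) ⟩
          x +ᴹ ((y +ᴹ z) +ᴹ w) ≈⟨ +ᴹ-congˡ (+ᴹ-congʳ (+ᴹ-comm y z)) ⟩
          x +ᴹ ((z +ᴹ y) +ᴹ w) ≈⟨ +ᴹ-congˡ (+ᴹ-assoc z y w) ⟩
          x +ᴹ (z +ᴹ (y +ᴹ w)) ≈⟨ ≈ᴹ-sym (+ᴹ-assoc x z _) ⟩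
          (x +ᴹ z) +ᴹ (y +ᴹ w) ∎

        *ₗ-neg : ∀ k (x : Op n) → k *ₗ (-ᴹ x) ≈ᴹ -ᴹ (k *ₗ x)
        *ₗ-neg k x = inverseʳ-uniqueᴹ _ _ (begin
          k *ₗ x +ᴹ k *ₗ (-ᴹ x) ≈⟨ ≈ᴹ-sym (*ₗ-distribˡ k x _) ⟩
          k *ₗ (x +ᴹ -ᴹ x)      ≈⟨ *ₗ-cong 𝕂.refl (-ᴹ‿inverseʳ x) ⟩
          k *ₗ 0ᴹ               ≈⟨ *ₗ-zeroʳ k ⟩
          0ᴹ                    ∎)

        ≈⇒~ : {x y : Op n} → x ≈ᴹ y → x ~ y
        ≈⇒~ p = resp (≈ᴹ-sym (x≈y⇒x∙y⁻¹≈ε p)) zero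

        ~-sym : {x y : Op n} → x ~ y → y ~ x
        ~-sym {x} {y} p = resp (≈ᴹ-trans (neg≈ _) (⁻¹-anti-homo‿- x y)) (scale (𝕂.- 𝕂.1#) p)

        ~-trans : {x y z : Op n} → x ~ y → y ~ z → x ~ z
        ~-trans {x} {y} {z} p q = resp (tele x y z) (add p q)

        +ᴹ-~ : {x x′ y y′ : Op n} → x ~ x′ → y ~ y′ → x +ᴹ y ~ x′ +ᴹ y′
        +ᴹ-~ {x} {x′} {y} {y′} p q = resp
          (≈ᴹ-trans (interchange x _ y _) (+ᴹ-congˡ (⁻¹-∙-comm x′ y′))) (add p q)

        *ₗ-~ : ∀ {k k′} {x x′ : Op n} → k 𝕂.≈ k′ → x ~ x′ → k *ₗ x ~ k′ *ₗ x′
        *ₗ-~ {k} {k′} {x} {x′} e p = resp (begin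
          k *ₗ (x +ᴹ -ᴹ x′)         ≈⟨ *ₗ-distribˡ k x _ ⟩
          k *ₗ x +ᴹ k *ₗ (-ᴹ x′)    ≈⟨ +ᴹ-congˡ (*ₗ-neg k x′) ⟩
          k *ₗ x +ᴹ -ᴹ (k *ₗ x′)    ≈⟨ +ᴹ-congˡ (-ᴹ‿cong (*ₗ-cong e ≈ᴹ-refl)) ⟩
          k *ₗ x +ᴹ -ᴹ (k′ *ₗ x′)   ∎) (scale k p)

        -ᴹ-~ : {x y : Op n} → x ~ y → -ᴹ x ~ -ᴹ y
        -ᴹ-~ {x} {y} p = resp (≈ᴹ-trans (neg≈ _) (≈ᴹ-sym (⁻¹-∙-comm x (-ᴹ y))))
                              (scale (𝕂.- 𝕂.1#) p)

      neg-∘ : ∀ {m n} (x : Op m) i (y : Op n) → (-ᴹ x) ∘⟨ i ⟩ y ≈ᴹ -ᴹ (x ∘⟨ i ⟩ y)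
      neg-∘ x i y = ≈ᴹ-trans (∘-cong i (≈ᴹ-sym (neg≈ x)) ≈ᴹ-refl) (≈ᴹ-trans (*-∘ _ x i y) (neg≈ _))

      ∘-neg : ∀ {m n} (x : Op m) i (y : Op n) → x ∘⟨ i ⟩ (-ᴹ y) ≈ᴹ -ᴹ (x ∘⟨ i ⟩ y)
      ∘-neg x i y = ≈ᴹ-trans (∘-cong i ≈ᴹ-refl (≈ᴹ-sym (neg≈ y))) (≈ᴹ-trans (∘-* _ x i y) (neg≈ _))

      ∘-~ : ∀ {m n} {x x′ : Op m} i {y y′ : Op n} → x ~ x′ → y ~ y′ → x ∘⟨ i ⟩ y ~ x′ ∘⟨ i ⟩ y′
      ∘-~ {x = x} {x′} i {y} {y′} p q = ~-trans
        (resp (≈ᴹ-trans (+-∘ x _ i y) (+ᴹ-congˡ (neg-∘ x′ i y))) (compˡ i y p))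
        (resp (≈ᴹ-trans (∘-+ x′ i y _) (+ᴹ-congˡ (∘-neg x′ i y′))) (compʳ x′ i q))

      quotientComponent : ∀ n → LeftModule 𝕂.ring m (c ⊔ m ⊔ ℓm ⊔ r)
      quotientComponent n = record
        { Carrierᴹ = Op n
        ; _≈ᴹ_     = _~_
        ; _+ᴹ_     = _+ᴹ_
        ; _*ₗ_     = _*ₗ_
        ; 0ᴹ       = 0ᴹ
        ; -ᴹ_      = -ᴹ_
        ; isLeftModule = record
          { isLeftSemimodule = record
            { +ᴹ-isCommutativeMonoid = record
              { isMonoid = record
                { isSemigroup = record
                  { isMagma = record
                    { isEquivalence = record { refl = ≈⇒~ ≈ᴹ-refl ; sym = ~-sym ; trans = ~-trans }
                    ; ∙-cong = +ᴹ-~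
                    }
                  ; assoc = λ x y z → ≈⇒~ (+ᴹ-assoc x y z)
                  }
                ; identity = (λ x → ≈⇒~ (+ᴹ-identityˡ x)) , (λ x → ≈⇒~ (+ᴹ-identityʳ x))
                }
              ; comm = λ x y → ≈⇒~ (+ᴹ-comm x y)
              }
            ; isPreleftSemimodule = record
              { *ₗ-cong      = *ₗ-~
              ; *ₗ-zeroˡ     = λ x → ≈⇒~ (*ₗ-zeroˡ x)
              ; *ₗ-distribʳ  = λ x k k′ → ≈⇒~ (*ₗ-distribʳ x k k′)
              ; *ₗ-identityˡ = λ x → ≈⇒~ (*ₗ-identityˡ x)
              ; *ₗ-assoc     = λ k k′ x → ≈⇒~ (*ₗ-assoc k k′ x)
              ; *ₗ-zeroʳ     = λ k → ≈⇒~ (*ₗ-zeroʳ k)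
              ; *ₗ-distribˡ  = λ k x y → ≈⇒~ (*ₗ-distribˡ k x y)
              }
            }
          ; -ᴹ‿cong    = -ᴹ-~
          ; -ᴹ‿inverse = (λ x → ≈⇒~ (-ᴹ‿inverseˡ x)) , (λ x → ≈⇒~ (-ᴹ‿inverseʳ x))
          }
        }

      quotient : Operad m (c ⊔ m ⊔ ℓm ⊔ r)
      quotient = record
        { component = quotientComponent
        ; unit      = unit
        ; _∘⟨_⟩_    = _∘⟨_⟩_
        ; ∘-cong    = ∘-~
        ; +-∘       = λ x x′ i y → ≈⇒~ (+-∘ x x′ i y)
        ; *-∘       = λ k x i y → ≈⇒~ (*-∘ k x i y)
        ; ∘-+       = λ x i y y′ → ≈⇒~ (∘-+ x i y y′)
        ; ∘-*       = λ k x i y → ≈⇒~ (∘-* k x i y)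
        ; unitˡ     = λ x → ≈⇒~ (unitˡ x)
        ; unitʳ     = λ x i e → ≈⇒~ (unitʳ x i e)
        ; seq       = λ x y z i j k p e → ≈⇒~ (seq x y z i j k p e)
        ; par       = λ x y z i k i′ k′ i<k p q e → ≈⇒~ (par x y z i k i′ k′ i<k p q e)
        }

  data Span {m ℓm v} (V : LeftModule 𝕂.ring m ℓm) (P : Pred (LeftModule.Carrierᴹ V) v) :
            Pred (LeftModule.Carrierᴹ V) (c ⊔ m ⊔ ℓm ⊔ v) where
    gen   : ∀ {x} → P x → Span V P x
    resp  : ∀ {x y} → LeftModule._≈ᴹ_ V x y → Span V P x → Span V P y
    zero  : Span V P (LeftModule.0ᴹ V)
    add   : ∀ {x y} → Span V P x → Span V P y → Span V P (LeftModule._+ᴹ_ V x y)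
    scale : ∀ {x} k → Span V P x → Span V P (LeftModule._*ₗ_ V k x)

  FreeOperad : Set → Operad c (c ⊔ ℓ)
  FreeOperad 𝔊 = Linearization (Trees 𝔊)

  InducedSpace : ∀ {𝔊 ℓr} → (∀ n → Rel (SetOperad.Op (Trees 𝔊) n) ℓr) →
                 ∀ n → Pred (Operad.Op (FreeOperad 𝔊) n) (c ⊔ ℓ ⊔ ℓr)
  InducedSpace {𝔊} E n = Span (Operad.component (FreeOperad 𝔊) n)
    (λ x → ∃₂ λ t t′ → E n t t′ × x ≡ ⟨ t ⟩ ⊕ ⊖ ⟨ t′ ⟩)

  AdmitsPresentation : ∀ {m ℓm r} → Operad m ℓm → (𝔊 : Set) →
                       (∀ n → Pred (Operad.Op (FreeOperad 𝔊) n) r) →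
                       Set (c ⊔ ℓ ⊔ m ⊔ ℓm ⊔ r)
  AdmitsPresentation 𝒪 𝔊 R = 𝒪 ≅ quotient (FreeOperad 𝔊) R

-- The monoid {0} ∪ [γ] is Fin (suc γ), and a : Fin γ is the letter suc a.
maxIsMonoid : ∀ γ → IsMonoid _≡_ (Max._⊔_ (Fin.≤-totalOrder (suc γ))) zero
maxIsMonoid γ = Max.⊔-isMonoid (Fin.≤-totalOrder (suc γ)) (λ _ → z≤n)

data 𝔊 (γ : ℕ) : Set where
  ⊣ ⊢ : Fin γ → 𝔊 γ

module _ {γ : ℕ} where
  open SetOperad (Trees (𝔊 γ))

  infix 7 _∘₁_ _∘₂_
  _∘₁_ _∘₂_ : 𝔊 γ → 𝔊 γ → Op 2
  x ∘₁ y = corolla x ∘⟨ zero ⟩ corolla y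
  x ∘₂ y = corolla x ∘⟨ suc zero ⟩ corolla y

  infix 4 _⇝_
  data _⇝_ : ∀ {n} → Op n → Op n → Set where
    assoc : ∀ a a′ → ⊣ a ∘₁ ⊢ a′ ⇝ ⊢ a′ ∘₂ ⊣ a
    <₁    : ∀ {a b} → a < b → ⊣ a ∘₁ ⊣ b ⇝ ⊣ a ∘₂ ⊢ b
    <₂    : ∀ {a b} → a < b → ⊢ a ∘₁ ⊣ b ⇝ ⊢ a ∘₂ ⊢ b
    <₃    : ∀ {a b} → a < b → ⊣ b ∘₁ ⊣ a ⇝ ⊣ a ∘₂ ⊣ b
    <₄    : ∀ {a b} → a < b → ⊢ a ∘₁ ⊢ b ⇝ ⊢ b ∘₂ ⊢ a
    ≤₁    : ∀ {c d} → c ≤ d → ⊣ d ∘₁ ⊣ d ⇝ ⊣ d ∘₂ ⊣ c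
    ≤₂    : ∀ {c d} → c ≤ d → ⊣ d ∘₂ ⊣ c ⇝ ⊣ d ∘₂ ⊢ c
    ≤₃    : ∀ {c d} → c ≤ d → ⊢ d ∘₁ ⊣ c ⇝ ⊢ d ∘₁ ⊢ c
    ≤₄    : ∀ {c d} → c ≤ d → ⊢ d ∘₁ ⊢ c ⇝ ⊢ d ∘₂ ⊢ d

module Diassociative {c ℓ₁ ℓ₂} (𝕂 : HeytingField c ℓ₁ ℓ₂) where
  open HeytingField 𝕂 using (heytingCommutativeRing)
  open HeytingCommutativeRing heytingCommutativeRing using (commutativeRing)
  open LinearOperads commutativeRing public

  T𝓜 : ℕ → Operad c (c ⊔ ℓ₁)
  T𝓜 γ = Linearization (Words (maxIsMonoid γ))

  data DiasGenerator (γ : ℕ) : ∀ n → Pred (Operad.Op (T𝓜 γ) n) c where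
    0a : ∀ a → DiasGenerator γ 1 ⟨ zero ∷ suc a ∷ [] ⟩
    a0 : ∀ a → DiasGenerator γ 1 ⟨ suc a ∷ zero ∷ [] ⟩

  Dias : ℕ → Operad (c ⊔ ℓ₁) (c ⊔ ℓ₁)
  Dias γ = suboperad (T𝓜 γ) (DiasGenerator γ)

  RelationSpace : ∀ γ n → Pred (Operad.Op (FreeOperad (𝔊 γ)) n) (c ⊔ ℓ₁)
  RelationSpace γ = InducedSpace (λ n → EqClosure (_⇝_ {γ} {n}))

{-# OPTIONS --safe #-}
-- Interpreting ⊣ₐ as 0a and ⊢ₐ as a0 sends a tree to a word with exactly one
-- letter 0, and both sides of each relation to the same word.  Conversely, the
-- relations rewrite every tree into a right comb of ⊢'s ending in a left comb of
-- ⊣'s, u₁ ⊢ (… (u_k ⊢ ((∣ ⊣ v₁) … ⊣ v_l))), which is read off from the word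
-- u₁ … u_k 0 v₁ … v_l of the tree: with a on top of b, the four relations that
-- reassociate ⊣ₐ and ⊢ₐ towards this shape all replace b by max(a, b).  Hence
-- reading off normal forms, extended linearly, inverts the interpretation of
-- trees modulo the relations in the span of the words of trees, which is Diasᵧ.

module Submission where

open import Defs
open import Algebra.Apartness.Bundles using (HeytingField; HeytingCommutativeRing)
open import Algebra.Bundles using (CommutativeRing)
import Algebra.Construct.NaturalChoice.Max as Max
open import Algebra.Module.Bundles using (LeftModule)
import Algebra.Properties.AbelianGroup as AbelianGroupProperties
open import Data.Fin.Base as Fin using (Fin; zero; suc; toℕ; fromℕ<)
import Data.Fin.Properties as Fin
open import Data.List.Base using (List; []; _∷_; _++_; map; foldl; foldr; length)
import Data.List.Properties as List
open import Data.Maybe.Base as Maybe using (Maybe; just; nothing)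
open import Data.Nat.Base as ℕ using (ℕ; zero; suc; _+_; s≤s)
import Data.Nat.Properties as ℕ
open import Data.Product.Base using (Σ-syntax; ∃₂; _×_; _,_; proj₁; proj₂)
open import Data.Sum.Base using (inj₁; inj₂)
open import Data.Vec.Base as Vec using (Vec; cast; fromList; toList)
import Data.Vec.Properties as Vec
open import Function.Base using (_∘_)
import Level
open import Relation.Binary.Bundles using (Setoid)
open import Relation.Binary.Construct.Closure.Equivalence as EqClosure using (EqClosure)
open import Relation.Binary.PropositionalEquality
  using (_≡_; refl; sym; trans; cong; cong₂; subst; isEquivalence; module ≡-Reasoning)
import Relation.Binary.Reasoning.Setoid as SetoidReasoning
open import Relation.Nullary.Decidable.Core using (yes; no)
open import Relation.Nullary.Negation.Core using (contradiction)

-- Words of trees and their compatibility with grafting.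

module Letters (γ : ℕ) where

  M : Set
  M = Fin (suc γ)

  infixl 6 _⊔_ _⊻_

  _⊔_ : M → M → M
  _⊔_ = Max._⊔_ (Fin.≤-totalOrder (suc γ))

  _⊻_ : Fin γ → Fin γ → Fin γ
  _⊻_ = Max._⊔_ (Fin.≤-totalOrder γ)

  open Max (Fin.≤-totalOrder (suc γ)) public using (x≤y⇒x⊔y≈y; x≤y⇒y⊔x≈y)
  open Max (Fin.≤-totalOrder γ) public using ()
    renaming (x≤y⇒x⊔y≈y to x≤y⇒x⊻y≈y; x≤y⇒y⊔x≈y to x≤y⇒y⊻x≈y)

  suc-⊔ : ∀ a b → suc a ⊔ suc b ≡ suc (a ⊻ b)
  suc-⊔ a b with ℕ.≤-total (toℕ a) (toℕ b)
  ... | inj₁ a≤b = trans (x≤y⇒x⊔y≈y (s≤s a≤b)) (cong suc (sym (x≤y⇒x⊻y≈y a≤b)))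
  ... | inj₂ b≤a = trans (x≤y⇒y⊔x≈y (s≤s b≤a)) (cong suc (sym (x≤y⇒y⊻x≈y b≤a)))

  left right : 𝔊 γ → M
  left  (⊣ a) = zero
  left  (⊢ a) = suc a
  right (⊣ a) = suc a
  right (⊢ a) = zero

  -- The operad morphism from trees to words with value `left g`, `right g` on a generator `g`.
  -- Lists keep the recursion free of length casts.
  letters : Tree (𝔊 γ) → List M
  letters leaf         = zero ∷ []
  letters (node g l r) = map (left g ⊔_) (letters l) ++ map (right g ⊔_) (letters r)

  length-letters : ∀ t → length (letters t) ≡ suc (nodes t)
  length-letters leaf         = refl
  length-letters (node g l r) = trans (List.length-++ (map (left g ⊔_) (letters l)))
    (trans (cong₂ _+_ (trans (List.length-map _ (letters l)) (length-letters l))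
                      (trans (List.length-map _ (letters r)) (length-letters r)))
           (cong suc (ℕ.+-suc (nodes l) (nodes r))))

  insertᴸ′ : List M → ℕ → List M → List M
  insertᴸ′ = insertᴸ (maxIsMonoid γ)

  -- Grafting in the left subtree commutes with taking maxima by associativity of `max`; grafting in
  -- the right subtree first skips the letters of the left one. The bound excludes positions past
  -- the last leaf, where the two sides follow different conventions.
  letters-graft : ∀ t i s → i ℕ.≤ nodes t →
                  letters (graft t i s) ≡ insertᴸ′ (letters t) i (letters s)
  letters-graft leaf zero s _ =
    sym (unitˡᴸ (maxIsMonoid γ) (letters s))
  letters-graft (node g l r) i s p with i ℕ.≤? nodes l
  ... | yes i≤l = trans
    (cong (λ w → map (left g ⊔_) w ++ map (right g ⊔_) (letters r)) (letters-graft l i s i≤l))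
    (sym (insert-map (maxIsMonoid γ) (left g) _ (letters l) i (letters s)
           (subst (i ℕ.<_) (sym (length-letters l)) (s≤s i≤l))))
  ... | no i≰l = begin
    ls ++ map (right g ⊔_) (letters (graft r j s))
      ≡⟨ cong (λ w → ls ++ map (right g ⊔_) w) (letters-graft r j s j≤r) ⟩
    ls ++ map (right g ⊔_) (insertᴸ′ (letters r) j (letters s))
      -- `insert-map` expects a word followed by a suffix, so an empty suffix is added and then
      -- removed again.
      ≡⟨ cong (ls ++_) (List.++-identityʳ _) ⟨
    ls ++ (map (right g ⊔_) (insertᴸ′ (letters r) j (letters s)) ++ [])
      ≡⟨ cong (ls ++_) (insert-map (maxIsMonoid γ) (right g) [] (letters r) j (letters s)
           (subst (j ℕ.<_) (sym (length-letters r)) (s≤s j≤r))) ⟨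
    ls ++ insertᴸ′ (map (right g ⊔_) (letters r) ++ []) j (letters s)
      ≡⟨ cong (λ w → ls ++ insertᴸ′ w j (letters s)) (List.++-identityʳ rs) ⟩
    ls ++ insertᴸ′ rs j (letters s)
      ≡⟨ insert-++ (maxIsMonoid γ) ls rs j (letters s) ⟨
    insertᴸ′ (ls ++ rs) (j + length ls) (letters s)
      ≡⟨ cong (λ k → insertᴸ′ (ls ++ rs) k (letters s)) j+∣ls∣≡i ⟩
    insertᴸ′ (ls ++ rs) i (letters s) ∎
    where
    open ≡-Reasoning
    ls = map (left g ⊔_) (letters l)
    rs = map (right g ⊔_) (letters r)
    j = i ℕ.∸ suc (nodes l)
    j≤r : j ℕ.≤ nodes r
    j≤r = ∸-bound {𝔊 γ} (nodes l) (nodes r) p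
    j+∣ls∣≡i : j + length ls ≡ i
    j+∣ls∣≡i = trans (cong (j +_) (trans (List.length-map _ (letters l)) (length-letters l)))
                     (ℕ.m∸n+n≡m (ℕ.≰⇒> i≰l))

  -- Normal forms and how to read them off from words.

  word : List (Fin γ) → List (Fin γ) → List M
  word u v = map suc u ++ zero ∷ map suc v

  infixl 6 _⊣*_
  infixr 6 _⊢*_

  _⊣*_ : Tree (𝔊 γ) → List (Fin γ) → Tree (𝔊 γ)
  _⊣*_ = foldl (λ t a → node (⊣ a) t leaf)

  _⊢*_ : List (Fin γ) → Tree (𝔊 γ) → Tree (𝔊 γ)
  u ⊢* t = foldr (λ a → node (⊢ a) leaf) t u

  normal : List (Fin γ) → List (Fin γ) → Tree (𝔊 γ)
  normal u v = u ⊢* (leaf ⊣* v)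

  -- The accumulator is the left comb built so far. The letter 0 has already been read, so a further
  -- one is a failure.
  parse⊣ : Tree (𝔊 γ) → List M → Maybe (Tree (𝔊 γ))
  parse⊣ t []          = just t
  parse⊣ t (zero  ∷ w) = nothing
  parse⊣ t (suc a ∷ w) = parse⊣ (node (⊣ a) t leaf) w

  -- Only words with exactly one letter zero have a parse.
  parse : List M → Maybe (Tree (𝔊 γ))
  parse []          = nothing
  parse (zero  ∷ w) = parse⊣ leaf w
  parse (suc a ∷ w) = Maybe.map (node (⊢ a) leaf) (parse w)

  parse⊣-map-suc : ∀ t v → parse⊣ t (map suc v) ≡ just (t ⊣* v)
  parse⊣-map-suc t []      = refl
  parse⊣-map-suc t (a ∷ v) = parse⊣-map-suc (node (⊣ a) t leaf) v

  parse-word : ∀ u v → parse (word u v) ≡ just (normal u v)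
  parse-word []      v = parse⊣-map-suc leaf v
  parse-word (a ∷ u) v = cong (Maybe.map (node (⊢ a) leaf)) (parse-word u v)

  -- Words under maxima, and invariance under the relations.

  map-⊔-suc : ∀ a u → map (suc a ⊔_) (map suc u) ≡ map suc (map (a ⊻_) u)
  map-⊔-suc a u = trans (sym (List.map-∘ u)) (trans (List.map-cong (suc-⊔ a) u) (List.map-∘ u))

  -- The only 0 turns into `a`. Hence at every node exactly one subtree loses its letter 0, and the
  -- word of the whole tree keeps exactly one.
  map-⊔-word : ∀ a u v → map (suc a ⊔_) (word u v) ≡ map suc (map (a ⊻_) u ++ a ∷ map (a ⊻_) v)
  map-⊔-word a u v = begin
    map (suc a ⊔_) (map suc u ++ zero ∷ map suc v)
      ≡⟨ List.map-++ (suc a ⊔_) (map suc u) _ ⟩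
    map (suc a ⊔_) (map suc u) ++ suc a ∷ map (suc a ⊔_) (map suc v)
      ≡⟨ cong₂ (λ x y → x ++ suc a ∷ y) (map-⊔-suc a u) (map-⊔-suc a v) ⟩
    map suc (map (a ⊻_) u) ++ map suc (a ∷ map (a ⊻_) v)
      ≡⟨ List.map-++ suc (map (a ⊻_) u) _ ⟨
    map suc (map (a ⊻_) u ++ a ∷ map (a ⊻_) v) ∎
    where open ≡-Reasoning

  word-++ʳ : ∀ u v v′ → word u v ++ map suc v′ ≡ word u (v ++ v′)
  word-++ʳ u v v′ = trans (List.++-assoc (map suc u) _ _)
    (cong (λ w → map suc u ++ zero ∷ w) (sym (List.map-++ suc v v′)))

  word-++ˡ : ∀ u′ u v → map suc u′ ++ word u v ≡ word (u′ ++ u) v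
  word-++ˡ u′ u v = trans (sym (List.++-assoc (map suc u′) (map suc u) _))
    (cong (_++ zero ∷ map suc v) (sym (List.map-++ suc u′ u)))

  ⊔-< : ∀ {a b} → a Fin.< b → suc a ⊔ suc b ≡ suc b
  ⊔-< a<b = x≤y⇒x⊔y≈y (s≤s (ℕ.<⇒≤ a<b))

  ⊔-≤ : ∀ {c d} → c Fin.≤ d → suc d ⊔ suc c ≡ suc d
  ⊔-≤ c≤d = x≤y⇒y⊔x≈y (s≤s c≤d)

  -- The two words differ only in maxima that the side condition evaluates. In `≤₂` and `≤₃` both
  -- words contain one, at different positions, so two evaluations are needed.
  ⇝-letters : ∀ {n} {t t′ : T (𝔊 γ) n} → t ⇝ t′ → letters (proj₁ t) ≡ letters (proj₁ t′)
  ⇝-letters (assoc a a′)       = refl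
  ⇝-letters (<₁ {a} a<b)       = cong (λ x → zero ∷ x ∷ suc a ∷ []) (sym (⊔-< a<b))
  ⇝-letters (<₂ {a} a<b)       = cong (λ x → suc a ∷ x ∷ zero ∷ []) (⊔-< a<b)
  ⇝-letters (<₃ {a} a<b)       = cong (λ x → zero ∷ suc a ∷ x ∷ []) (sym (⊔-< a<b))
  ⇝-letters (<₄ {a} a<b)       = cong (λ x → x ∷ suc a ∷ zero ∷ []) (⊔-< a<b)
  ⇝-letters (≤₁ {d = d} c≤d)   = cong (λ x → zero ∷ suc d ∷ x ∷ []) (sym (⊔-≤ c≤d))
  ⇝-letters (≤₂ {c} {d} c≤d)   =
    trans (cong (λ x → zero ∷ suc d ∷ x ∷ []) (⊔-≤ c≤d))
          (cong (λ x → zero ∷ x ∷ suc d ∷ []) (sym (⊔-≤ c≤d)))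
  ⇝-letters (≤₃ {c} {d} c≤d)   =
    trans (cong (λ x → suc d ∷ x ∷ zero ∷ []) (⊔-≤ c≤d))
          (cong (λ x → x ∷ suc d ∷ zero ∷ []) (sym (⊔-≤ c≤d)))
  ⇝-letters (≤₄ {d = d} c≤d)   = cong (λ x → x ∷ suc d ∷ zero ∷ []) (⊔-≤ c≤d)

-- Rewriting trees to normal form modulo the relations.

module Rewriting {c ℓ₁ ℓ₂} (𝕂 : HeytingField c ℓ₁ ℓ₂) (γ : ℕ) where
  open Diassociative 𝕂
  open Letters γ

  F : Operad c _
  F = FreeOperad (𝔊 γ)

  Q : Operad c _
  Q = quotient F (RelationSpace γ)

  module Q = Operad Q

  infix 4 _∼_ _≈_

  _∼_ : ∀ {n} → Lin (T (𝔊 γ) n) → Lin (T (𝔊 γ) n) → Set _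
  _∼_ {n} x y = LeftModule._≈ᴹ_ (quotientComponent F (RelationSpace γ) n) x y

  -- The degree is existentially quantified so that the two sides of a
  -- relation need not have syntactically equal numbers of nodes.
  data _≈_ (t t′ : Tree (𝔊 γ)) : Set (c Level.⊔ ℓ₁) where
    related : ∀ {n} (p : nodes t ≡ n) (p′ : nodes t′ ≡ n) → ⟨ t , p ⟩ ∼ ⟨ t′ , p′ ⟩ → t ≈ t′

  ≈-refl : ∀ {t} → t ≈ t
  ≈-refl = related refl refl (Q.C.≈ᴹ-refl {nodes _})

  ≈-sym : ∀ {t t′} → t ≈ t′ → t′ ≈ t
  ≈-sym (related {n} p p′ r) = related p′ p (Q.C.≈ᴹ-sym {n} r)

  ≈-trans : ∀ {t t′ t″} → t ≈ t′ → t′ ≈ t″ → t ≈ t″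
  ≈-trans (related p refl r) (related {n} refl p″ r′) = related p p″ (Q.C.≈ᴹ-trans {n} r r′)

  treeSetoid : Setoid _ _
  treeSetoid = record
    { Carrier       = Tree (𝔊 γ)
    ; _≈_           = _≈_
    ; isEquivalence = record { refl = ≈-refl ; sym = ≈-sym ; trans = ≈-trans }
    }

  graft-cong : ∀ {t t′ s s′} i → i ℕ.≤ nodes t → t ≈ t′ → s ≈ s′ → graft t i s ≈ graft t′ i s′
  graft-cong {t} {t′} {s} {s′} i i≤t (related refl p′ r) (related q q′ r′) =
    -- Composition in the quotient takes a position in `Fin`, which the bound on `i` provides.
    subst (λ k → graft t k s ≈ graft t′ k s′) (Fin.toℕ-fromℕ< (s≤s i≤t))
      (related _ _ (Q.∘-cong (fromℕ< (s≤s i≤t)) r r′))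

  node-cong : ∀ {g l l′ r r′} → l ≈ l′ → r ≈ r′ → node g l r ≈ node g l′ r′
  node-cong {g} l≈l′ r≈r′ =
    -- A node is a corolla with its subtrees grafted on; grafting the right one first leaves the
    -- number of the left leaf unchanged.
    graft-cong 0 ℕ.z≤n (graft-cong {node g leaf leaf} 1 ℕ.≤-refl ≈-refl r≈r′) l≈l′

  -- Meant for trees with three leaves. Going from right to left keeps the numbers of the remaining
  -- leaves valid.
  substitute : Tree (𝔊 γ) → (x y z : Tree (𝔊 γ)) → Tree (𝔊 γ)
  substitute t x y z = graft (graft (graft t 2 z) 1 y) 0 x

  -- The ideal is closed under composition, so a relation persists with arbitrary subtrees on its
  -- three leaves.
  relation : ∀ {t t′ : T (𝔊 γ) 2} → t ⇝ t′ → ∀ x y z →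
             substitute (proj₁ t) x y z ≈ substitute (proj₁ t′) x y z
  relation {t , p} {t′ , p′} r x y z =
    graft-cong 0 ℕ.z≤n (graft-cong 1 1≤ (graft-cong 2 2≤ t≈t′ (≈-refl {z})) (≈-refl {y}))
               (≈-refl {x})
    where
    t≈t′ : t ≈ t′
    t≈t′ = related p p′ (Ideal.gen (Span.gen (_ , _ , EqClosure.return r , refl)))
    2≤ : 2 ℕ.≤ nodes t
    2≤ = ℕ.≤-reflexive (sym p)
    1≤ : 1 ℕ.≤ nodes (graft t 2 z)
    1≤ = ≤-graft′ t 2 z (ℕ.≤-trans (ℕ.n≤1+n 1) 2≤)

  ⊣-⊢ : ∀ a b x y z → node (⊣ a) (node (⊢ b) x y) z ≈ node (⊢ b) x (node (⊣ a) y z)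
  ⊣-⊢ a b = relation (assoc a b)

  -- The maximum merges two families of relations: it is `b` in the strict ones, where `a < b`, and
  -- `a` in the chains, where `b ≤ a`. The next three rules arise in the same way.
  ⊣-⊢ʳ : ∀ a b x y z → node (⊣ a) x (node (⊢ b) y z) ≈ node (⊣ a) (node (⊣ (a ⊻ b)) x y) z
  ⊣-⊢ʳ a b x y z with ℕ.<-≤-connex (toℕ a) (toℕ b)
  ... | inj₁ a<b rewrite x≤y⇒x⊻y≈y (ℕ.<⇒≤ a<b) = ≈-sym (relation (<₁ a<b) x y z)
  ... | inj₂ b≤a rewrite x≤y⇒y⊻x≈y b≤a         =
    ≈-sym (≈-trans (relation (≤₁ b≤a) x y z) (relation (≤₂ b≤a) x y z))

  ⊣-⊣ʳ : ∀ a b x y z → node (⊣ a) x (node (⊣ b) y z) ≈ node (⊣ (a ⊻ b)) (node (⊣ a) x y) z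
  ⊣-⊣ʳ a b x y z with ℕ.<-≤-connex (toℕ a) (toℕ b)
  ... | inj₁ a<b rewrite x≤y⇒x⊻y≈y (ℕ.<⇒≤ a<b) = ≈-sym (relation (<₃ a<b) x y z)
  ... | inj₂ b≤a rewrite x≤y⇒y⊻x≈y b≤a         = ≈-sym (relation (≤₁ b≤a) x y z)

  ⊢-⊢ˡ : ∀ a b x y z → node (⊢ a) (node (⊢ b) x y) z ≈ node (⊢ (a ⊻ b)) x (node (⊢ a) y z)
  ⊢-⊢ˡ a b x y z with ℕ.<-≤-connex (toℕ a) (toℕ b)
  ... | inj₁ a<b rewrite x≤y⇒x⊻y≈y (ℕ.<⇒≤ a<b) = relation (<₄ a<b) x y z
  ... | inj₂ b≤a rewrite x≤y⇒y⊻x≈y b≤a         = relation (≤₄ b≤a) x y z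

  ⊢-⊣ˡ : ∀ a b x y z → node (⊢ a) (node (⊣ b) x y) z ≈ node (⊢ a) x (node (⊢ (a ⊻ b)) y z)
  ⊢-⊣ˡ a b x y z with ℕ.<-≤-connex (toℕ a) (toℕ b)
  ... | inj₁ a<b rewrite x≤y⇒x⊻y≈y (ℕ.<⇒≤ a<b) = relation (<₂ a<b) x y z
  ... | inj₂ b≤a rewrite x≤y⇒y⊻x≈y b≤a         =
    ≈-trans (relation (≤₃ b≤a) x y z) (relation (≤₄ b≤a) x y z)

  -- Moving a node past combs.

  ⊣*-cong : ∀ v {x y} → x ≈ y → x ⊣* v ≈ y ⊣* v
  ⊣*-cong []      p = p
  ⊣*-cong (a ∷ v) p = ⊣*-cong v (node-cong p ≈-refl)

  ⊢*-cong : ∀ u {x y} → x ≈ y → u ⊢* x ≈ u ⊢* y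
  ⊢*-cong []      p = p
  ⊢*-cong (a ∷ u) p = node-cong ≈-refl (⊢*-cong u p)

  ⊣-⊢* : ∀ a u x y → node (⊣ a) (u ⊢* x) y ≈ u ⊢* node (⊣ a) x y
  ⊣-⊢* a []      x y = ≈-refl
  ⊣-⊢* a (b ∷ u) x y = ≈-trans (⊣-⊢ a b leaf (u ⊢* x) y) (node-cong ≈-refl (⊣-⊢* a u x y))

  ⊣-⊢*ʳ : ∀ a x u y → node (⊣ a) x (u ⊢* y) ≈ node (⊣ a) (x ⊣* map (a ⊻_) u) y
  ⊣-⊢*ʳ a x []      y = ≈-refl
  ⊣-⊢*ʳ a x (b ∷ u) y = ≈-trans (⊣-⊢ʳ a b x leaf (u ⊢* y)) (⊣-⊢*ʳ a _ u y)

  ⊣-⊣*ʳ : ∀ a x y v → node (⊣ a) x (y ⊣* v) ≈ node (⊣ a) x y ⊣* map (a ⊻_) v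
  ⊣-⊣*ʳ a x y []      = ≈-refl
  -- The head `b` labels the innermost node of the left comb, so the outer letters are moved first.
  ⊣-⊣*ʳ a x y (b ∷ v) = ≈-trans (⊣-⊣*ʳ a x _ v) (⊣*-cong (map (a ⊻_) v) (⊣-⊣ʳ a b x y leaf))

  ⊢-⊢*ˡ : ∀ a u x y → node (⊢ a) (u ⊢* x) y ≈ map (a ⊻_) u ⊢* node (⊢ a) x y
  ⊢-⊢*ˡ a []      x y = ≈-refl
  ⊢-⊢*ˡ a (b ∷ u) x y = ≈-trans (⊢-⊢ˡ a b leaf (u ⊢* x) y) (node-cong ≈-refl (⊢-⊢*ˡ a u x y))

  ⊢-⊣*ˡ : ∀ a x v y → node (⊢ a) (x ⊣* v) y ≈ node (⊢ a) x (map (a ⊻_) v ⊢* y)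
  ⊢-⊣*ˡ a x []      y = ≈-refl
  ⊢-⊣*ˡ a x (b ∷ v) y = ≈-trans (⊢-⊣*ˡ a _ v y) (⊢-⊣ˡ a b x leaf (map (a ⊻_) v ⊢* y))

  -- The letters of `word u v` after taking maxima with `a`, as computed in `map-⊔-word`.
  shade : Fin γ → List (Fin γ) → List (Fin γ) → List (Fin γ)
  shade a u v = map (a ⊻_) u ++ a ∷ map (a ⊻_) v

  -- The right comb `u` moves to the outside; then all nodes of the right subtree become `⊣` nodes
  -- of the left comb, with letters raised by `a`.
  ⊣-normal : ∀ a u v u′ v′ →
             node (⊣ a) (normal u v) (normal u′ v′) ≈ normal u (v ++ shade a u′ v′)
  ⊣-normal a u v u′ v′ = begin
    node (⊣ a) (u ⊢* y) (u′ ⊢* (leaf ⊣* v′))                 ≈⟨ ⊣-⊢* a u y _ ⟩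
    u ⊢* node (⊣ a) y (u′ ⊢* (leaf ⊣* v′))                   ≈⟨ ⊢*-cong u (⊣-⊢*ʳ a y u′ _) ⟩
    u ⊢* node (⊣ a) (y ⊣* map (a ⊻_) u′) (leaf ⊣* v′)        ≈⟨ ⊢*-cong u (⊣-⊣*ʳ a _ leaf v′) ⟩
    u ⊢* (y ⊣* map (a ⊻_) u′ ⊣* (a ∷ map (a ⊻_) v′))
      ≡⟨ cong (u ⊢*_) (List.foldl-++ _ y (map (a ⊻_) u′) _) ⟨
    u ⊢* (y ⊣* shade a u′ v′)
      ≡⟨ cong (u ⊢*_) (List.foldl-++ _ leaf v _) ⟨
    u ⊢* (leaf ⊣* (v ++ shade a u′ v′))                      ∎
    where
    open SetoidReasoning treeSetoid
    y = leaf ⊣* v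

  ⊢-normal : ∀ a u v u′ v′ →
             node (⊢ a) (normal u v) (normal u′ v′) ≈ normal (shade a u v ++ u′) v′
  ⊢-normal a u v u′ v′ = begin
    node (⊢ a) (u ⊢* (leaf ⊣* v)) (u′ ⊢* y)                  ≈⟨ ⊢-⊢*ˡ a u _ _ ⟩
    map (a ⊻_) u ⊢* node (⊢ a) (leaf ⊣* v) (u′ ⊢* y)
      ≈⟨ ⊢*-cong (map (a ⊻_) u) (⊢-⊣*ˡ a leaf v _) ⟩
    map (a ⊻_) u ⊢* (a ∷ map (a ⊻_) v) ⊢* u′ ⊢* y
      ≡⟨ List.foldr-++ _ _ (map (a ⊻_) u) _ ⟨
    shade a u v ⊢* u′ ⊢* y                                   ≡⟨ List.foldr-++ _ y (shade a u v) u′ ⟨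
    (shade a u v ++ u′) ⊢* y                                 ∎
    where
    open SetoidReasoning treeSetoid
    y = leaf ⊣* v′

  map-zero⊔ : ∀ w → map (zero ⊔_) w ≡ w
  map-zero⊔ w = trans (sym (List.++-identityʳ _)) (unitˡᴸ (maxIsMonoid γ) w)

  -- The same `u` and `v` serve for the normal form and for the word, so the word alone determines
  -- the class of the tree.
  normalise : ∀ t → ∃₂ λ u v → t ≈ normal u v × letters t ≡ word u v
  normalise leaf = [] , [] , ≈-refl , refl
  normalise (node g l r) with normalise l | normalise r
  normalise (node (⊣ a) l r) | u , v , p , e | u′ , v′ , p′ , e′ =
    u , v ++ shade a u′ v′ , ≈-trans (node-cong p p′) (⊣-normal a u v u′ v′) ,
    trans (cong₂ (λ x y → map (zero ⊔_) x ++ map (suc a ⊔_) y) e e′)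
      (trans (cong₂ _++_ (map-zero⊔ _) (map-⊔-word a u′ v′)) (word-++ʳ u v _))
  normalise (node (⊢ a) l r) | u , v , p , e | u′ , v′ , p′ , e′ =
    shade a u v ++ u′ , v′ , ≈-trans (node-cong p p′) (⊢-normal a u v u′ v′) ,
    trans (cong₂ (λ x y → map (suc a ⊔_) x ++ map (zero ⊔_) y) e e′)
      (trans (cong₂ _++_ (map-⊔-word a u v) (map-zero⊔ _)) (word-++ˡ _ u′ v′))

-- The interpretation of trees as words, extended linearly.

module Isomorphism {c ℓ₁ ℓ₂} (𝕂 : HeytingField c ℓ₁ ℓ₂) (γ : ℕ) where
  open Diassociative 𝕂
  open Letters γ
  open Rewriting 𝕂 γ

  W : SetOperad
  W = Words (maxIsMonoid γ)

  module W = SetOperad W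
  module K = CommutativeRing
    (HeytingCommutativeRing.commutativeRing (HeytingField.heytingCommutativeRing 𝕂))

  evaluate : ∀ {n} → T (𝔊 γ) n → Vec M (suc n)
  evaluate (t , p) = cast (trans (length-letters t) (cong suc p)) (fromList (letters t))

  toList-evaluate : ∀ {n} (t : T (𝔊 γ) n) → toList (evaluate t) ≡ letters (proj₁ t)
  toList-evaluate (t , p) = trans (Vec.toList-cast _ (fromList (letters t)))
                                  (Vec.toList∘fromList (letters t))

  evaluate-∘ : ∀ {m n} (t : T (𝔊 γ) m) i (s : T (𝔊 γ) n) →
               evaluate (SetOperad._∘⟨_⟩_ (Trees (𝔊 γ)) t i s) ≡ evaluate t W.∘⟨ i ⟩ evaluate s
  evaluate-∘ t i s = vec≡ (maxIsMonoid γ) (begin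
    toList (evaluate (SetOperad._∘⟨_⟩_ (Trees (𝔊 γ)) t i s))
      ≡⟨ toList-evaluate (SetOperad._∘⟨_⟩_ (Trees (𝔊 γ)) t i s) ⟩
    letters (graft (proj₁ t) (toℕ i) (proj₁ s))
      ≡⟨ letters-graft (proj₁ t) (toℕ i) (proj₁ s) (≤-nodes (𝔊 γ) t i) ⟩
    insertᴸ′ (letters (proj₁ t)) (toℕ i) (letters (proj₁ s))
      ≡⟨ cong₂ (λ x y → insertᴸ′ x (toℕ i) y) (toList-evaluate t) (toList-evaluate s) ⟨
    insertᴸ′ (toList (evaluate t)) (toℕ i) (toList (evaluate s))
      ≡⟨ toList-insert (maxIsMonoid γ) (evaluate t) i (evaluate s) ⟨
    toList (evaluate t W.∘⟨ i ⟩ evaluate s) ∎)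
    where open ≡-Reasoning

  φ : ∀ {n} → Lin (T (𝔊 γ) n) → Lin (Vec M (suc n))
  φ = extend (⟨_⟩ ∘ evaluate)

  φ-∘ : ∀ {m n} (x : Lin (T (𝔊 γ) m)) i (y : Lin (T (𝔊 γ) n)) →
        φ (compose (Trees (𝔊 γ)) x i y) ≋ compose W (φ x) i (φ y)
  φ-∘ x i y = linear-ext
    (∘-linear (extend-cong _) (extend-linear _) (linearˡ (Trees (𝔊 γ)) i y))
    (∘-linear (comp-congˡ W i (φ y)) (linearˡ W i (φ y)) (extend-linear _))
    (λ t → linear-ext
      (∘-linear (extend-cong _) (extend-linear _) (linearʳ (Trees (𝔊 γ)) ⟨ t ⟩ i))
      (∘-linear (comp-congʳ W ⟨ evaluate t ⟩ i) (linearʳ W ⟨ evaluate t ⟩ i) (extend-linear _))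
      (λ s → ≡⇒≋ W (cong ⟨_⟩ (evaluate-∘ t i s))) y) x

  evaluate-⇝ : ∀ {n} {t t′ : T (𝔊 γ) n} → EqClosure _⇝_ t t′ → evaluate t ≡ evaluate t′
  evaluate-⇝ {t = t} {t′} r = vec≡ (maxIsMonoid γ)
    (trans (toList-evaluate t)
      (trans (EqClosure.gfold isEquivalence (letters ∘ proj₁) ⇝-letters r)
             (sym (toList-evaluate t′))))

  φ-RelationSpace : ∀ {n x} → RelationSpace γ n x → φ x ≋ 𝟎
  φ-RelationSpace (gen (t , t′ , r , refl)) =
    ≋-trans (⊕-cong (≡⇒≋ W (cong ⟨_⟩ (evaluate-⇝ r))) ≋-refl) (⊖-inverseʳ _)
  φ-RelationSpace (resp e p)  = ≋-trans (extend-cong _ (≋-sym e)) (φ-RelationSpace p)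
  φ-RelationSpace zero        = ≋-refl
  φ-RelationSpace (add p q)   =
    ≋-trans (⊕-cong (φ-RelationSpace p) (φ-RelationSpace q)) (⊕-identity 𝟎)
  φ-RelationSpace (scale k p) = ≋-trans (·-cong K.refl (φ-RelationSpace p)) (·-zeroʳ k)

  -- Since `φ` respects composition, vanishing on the relations spreads to the ideal, which makes
  -- `φ` well defined on the quotient.
  φ-Ideal : ∀ {n x} → Ideal F (RelationSpace γ) n x → φ x ≋ 𝟎
  φ-Ideal (gen r)             = φ-RelationSpace r
  φ-Ideal (resp e p)          = ≋-trans (extend-cong _ (≋-sym e)) (φ-Ideal p)
  φ-Ideal zero                = ≋-refl
  φ-Ideal (add p q)           = ≋-trans (⊕-cong (φ-Ideal p) (φ-Ideal q)) (⊕-identity 𝟎)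
  φ-Ideal (scale k p)         = ≋-trans (·-cong K.refl (φ-Ideal p)) (·-zeroʳ k)
  φ-Ideal (compˡ {x = x} i y p) = ≋-trans (φ-∘ x i y) (comp-congˡ W i (φ y) (φ-Ideal p))
  φ-Ideal (compʳ {y = y} x i p) = ≋-trans (φ-∘ x i y)
    (≋-trans (comp-congʳ W (φ x) i (φ-Ideal p)) (IsLinear.f-𝟎 (linearʳ W (φ x) i)))

  φ-cong : ∀ {n} {x y : Lin (T (𝔊 γ) n)} → x ∼ y → φ x ≋ φ y
  φ-cong {n} p = GroupProperties.x∙y⁻¹≈ε⇒x≈y _ _ (φ-Ideal p)
    where
    module GroupProperties =
      AbelianGroupProperties (LeftModule.+ᴹ-abelianGroup (Free (Vec M (suc n))))

  -- The inverse map, given by parsing.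

  toBasis : ∀ n → Maybe (Tree (𝔊 γ)) → Lin (T (𝔊 γ) n)
  -- Zero is a default here and below: the word of a tree of degree `n` parses to a tree with `n`
  -- nodes.
  toBasis n nothing  = 𝟎
  toBasis n (just t) with nodes t ℕ.≟ n
  ... | yes p = ⟨ t , p ⟩
  ... | no  _ = 𝟎

  toBasis-just : ∀ {n t} (p : nodes t ≡ n) → toBasis n (just t) ≡ ⟨ t , p ⟩
  toBasis-just {n} {t} p with nodes t ℕ.≟ n
  ... | yes q = cong (λ q → ⟨ t , q ⟩) (ℕ.≡-irrelevant q p)
  ... | no ¬p = contradiction p ¬p

  ψ : ∀ {n} → Lin (Vec M (suc n)) → Lin (T (𝔊 γ) n)
  ψ {n} = extend (toBasis n ∘ parse ∘ toList)

  -- Parsing the word of `t` yields the normal form found by `normalise`, which is equivalent to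
  -- `t`.
  ψ-evaluate : ∀ {n} (t : T (𝔊 γ) n) → ψ ⟨ evaluate t ⟩ ∼ ⟨ t ⟩
  ψ-evaluate {n} (t , p) with normalise t
  ... | u , v , related {m} q q′ r , e rewrite toList-evaluate (t , p) | e | parse-word u v
      with trans (sym q) p
  ... | refl rewrite toBasis-just q′ | ℕ.≡-irrelevant q p = Q.C.≈ᴹ-sym {n} r

  ψ-φ : ∀ {n} (x : Lin (T (𝔊 γ) n)) → ψ (φ x) ∼ x
  ψ-φ     ⟨ t ⟩   = ψ-evaluate t
  ψ-φ {n} 𝟎       = Q.C.≈ᴹ-refl {n}
  ψ-φ {n} (x ⊕ y) = Q.C.+ᴹ-cong {n} (ψ-φ x) (ψ-φ y)
  ψ-φ {n} (k · x) = Q.C.*ₗ-cong {n} K.refl (ψ-φ x)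

  ψ-cong : ∀ {n} {x y : Lin (Vec M (suc n))} → x ≋ y → ψ x ∼ ψ y
  ψ-cong p = ≈⇒~ F (RelationSpace γ) (extend-cong _ p)

  -- The suboperad `Dias` as the image of `φ`.

  InImage : ∀ {n} → Lin (Vec M (suc n)) → Set _
  InImage x = Σ[ z ∈ _ ] x ≋ φ z

  Dias⊆image : ∀ {n x} → Generated (T𝓜 γ) (DiasGenerator γ) n x → InImage x
  Dias⊆image (gen (0a a)) = ⟨ corolla (⊣ a) ⟩ , ≋-refl
  Dias⊆image (gen (a0 a)) = ⟨ corolla (⊢ a) ⟩ , ≋-refl
  Dias⊆image (resp e p) with Dias⊆image p
  ... | z , q = z , ≋-trans (≋-sym e) q
  Dias⊆image zero = 𝟎 , ≋-refl
  Dias⊆image (add p q) with Dias⊆image p | Dias⊆image q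
  ... | z , e | w , f = z ⊕ w , ⊕-cong e f
  Dias⊆image (scale k p) with Dias⊆image p
  ... | z , e = k · z , ·-cong K.refl e
  Dias⊆image one = ⟨ leaf , refl ⟩ , ≋-refl
  Dias⊆image (comp {x = x} i p q) with Dias⊆image p | Dias⊆image q
  ... | z , e | w , f = compose (Trees (𝔊 γ)) z i w ,
    ≋-trans (comp-cong W {x = x} i e f) (≋-sym (φ-∘ z i w))

  -- Comparing lists allows degrees that agree only propositionally; their equality is recovered
  -- from the lengths.
  generated-toList : ∀ {m n} {u : Vec M (suc m)} {v : Vec M (suc n)} → toList u ≡ toList v →
                     Generated (T𝓜 γ) (DiasGenerator γ) m ⟨ u ⟩ →
                     Generated (T𝓜 γ) (DiasGenerator γ) n ⟨ v ⟩
  generated-toList {u = u} {v} e p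
    with trans (sym (Vec.length-toList u)) (trans (cong length e) (Vec.length-toList v))
  ... | refl = subst (λ w → Generated _ _ _ ⟨ w ⟩) (vec≡ (maxIsMonoid γ) e) p

  generator : ∀ g → Generated (T𝓜 γ) (DiasGenerator γ) 1 ⟨ left g Vec.∷ right g Vec.∷ Vec.[] ⟩
  generator (⊣ a) = gen (0a a)
  generator (⊢ a) = gen (a0 a)

  evaluate-generated : ∀ t → Generated (T𝓜 γ) (DiasGenerator γ) (nodes t) ⟨ evaluate (t , refl) ⟩
  evaluate-generated leaf         = one
  evaluate-generated (node g l r) = generated-toList letters≡
    -- The right subtree is inserted first, so the degree adds the nodes of `r` before those of `l`,
    -- unlike `nodes`.
    (comp zero (comp (suc zero) (generator g) (evaluate-generated r)) (evaluate-generated l))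
    where
    open ≡-Reasoning
    wl = evaluate (l , refl)
    wr = evaluate (r , refl)
    wg = left g Vec.∷ right g Vec.∷ Vec.[]
    letters≡ : toList ((wg W.∘⟨ suc zero ⟩ wr) W.∘⟨ zero ⟩ wl)
               ≡ toList (evaluate (node g l r , refl))
    letters≡ = begin
      toList ((wg W.∘⟨ suc zero ⟩ wr) W.∘⟨ zero ⟩ wl)
        ≡⟨ toList-insert (maxIsMonoid γ) (wg W.∘⟨ suc zero ⟩ wr) zero wl ⟩
      insertᴸ′ (toList (wg W.∘⟨ suc zero ⟩ wr)) 0 (toList wl)
        ≡⟨ cong₂ (λ x y → insertᴸ′ x 0 y) (toList-insert (maxIsMonoid γ) wg (suc zero) wr)
             (toList-evaluate (l , refl)) ⟩
      map (left g ⊔_) (letters l) ++ (map (right g ⊔_) (toList wr) ++ [])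
        ≡⟨ cong (map (left g ⊔_) (letters l) ++_) (List.++-identityʳ _) ⟩
      map (left g ⊔_) (letters l) ++ map (right g ⊔_) (toList wr)
        ≡⟨ cong (λ w → map (left g ⊔_) (letters l) ++ map (right g ⊔_) w)
             (toList-evaluate (r , refl)) ⟩
      letters (node g l r)
        ≡⟨ toList-evaluate (node g l r , refl) ⟨
      toList (evaluate (node g l r , refl)) ∎

  image⊆Dias : ∀ {n} (z : Lin (T (𝔊 γ) n)) → Generated (T𝓜 γ) (DiasGenerator γ) n (φ z)
  image⊆Dias ⟨ t , refl ⟩ = evaluate-generated t
  image⊆Dias 𝟎            = zero
  image⊆Dias (x ⊕ y)      = add (image⊆Dias x) (image⊆Dias y)
  image⊆Dias (k · x)      = scale k (image⊆Dias x)

  -- On the image, `ψ` undoes `φ` modulo the relations, so it inherits compatibility with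
  -- composition from `φ`.
  ψ-∘ : ∀ {m n} {x : Lin (Vec M (suc m))} i {y : Lin (Vec M (suc n))} → InImage x → InImage y →
        ψ (compose W x i y) ∼ compose (Trees (𝔊 γ)) (ψ x) i (ψ y)
  ψ-∘ {m} {n} {x} i {y} (z , x≋φz) (w , y≋φw) = begin
    ψ (compose W x i y)                      ≈⟨ ψ-cong (comp-cong W {x = x} i x≋φz y≋φw) ⟩
    ψ (compose W (φ z) i (φ w))              ≈⟨ ψ-cong (φ-∘ z i w) ⟨
    ψ (φ (compose (Trees (𝔊 γ)) z i w))      ≈⟨ ψ-φ _ ⟩
    compose (Trees (𝔊 γ)) z i w
      ≈⟨ Q.∘-cong i (≈-ψ {z = z} x≋φz) (≈-ψ {z = w} y≋φw) ⟨
    compose (Trees (𝔊 γ)) (ψ x) i (ψ y)      ∎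
    where
    open SetoidReasoning (Q.C.≈ᴹ-setoid {m + n})
    ≈-ψ : ∀ {n} {x : Lin (Vec M (suc n))} {z : Lin (T (𝔊 γ) n)} → x ≋ φ z → ψ x ∼ z
    ≈-ψ {n} {z = z} e = Q.C.≈ᴹ-trans {n} (ψ-cong e) (ψ-φ z)

  -- Preimages of `x` and `y` under `φ` are equivalent because `ψ` undoes `φ`, and `φ` respects the
  -- equivalence.
  ψ-injective : ∀ {n} {x y : Lin (Vec M (suc n))} → InImage x → InImage y → ψ x ∼ ψ y → x ≋ y
  ψ-injective {n} {x} {y} (z , x≋φz) (w , y≋φw) p =
    ≋-trans x≋φz (≋-trans (φ-cong z∼w) (≋-sym y≋φw))
    where
    open SetoidReasoning (Q.C.≈ᴹ-setoid {n})
    z∼w : z ∼ w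
    z∼w = begin
      z       ≈⟨ ψ-φ z ⟨
      ψ (φ z) ≈⟨ ψ-cong x≋φz ⟨
      ψ x     ≈⟨ p ⟩
      ψ y     ≈⟨ ψ-cong y≋φw ⟩
      ψ (φ w) ≈⟨ ψ-φ w ⟩
      w       ∎

  Dias≅Q : Dias γ ≅ Q
  Dias≅Q = record
    { ⟦_⟧ = ψ ∘ proj₁
    ; isLeftModuleIsomorphism = λ n → record
      { isLeftModuleMonomorphism = record
        { isLeftModuleHomomorphism = record
          { +ᴹ-isGroupHomomorphism = record
            { isMonoidHomomorphism = record
              { isMagmaHomomorphism = record
                { isRelHomomorphism = record { cong = ψ-cong }
                -- As `ψ` is a linear extension, this and the other linearity laws hold by
                -- computation.
                ; homo = λ _ _ → Q.C.≈ᴹ-refl {n}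
                }
              ; ε-homo = Q.C.≈ᴹ-refl {n}
              }
            ; ⁻¹-homo = λ _ → Q.C.≈ᴹ-refl {n}
            }
          ; *ₗ-homo = λ _ _ → Q.C.≈ᴹ-refl {n}
          }
        ; injective = λ { {_ , p} {_ , q} → ψ-injective (Dias⊆image p) (Dias⊆image q) }
        }
      ; surjective = λ z → (φ z , image⊆Dias z) ,
          λ x≋φz → Q.C.≈ᴹ-trans {n} (ψ-cong x≋φz) (ψ-φ z)
      }
    ; unit-homo = ψ-φ ⟨ leaf , refl ⟩
    ; ∘-homo = λ { (_ , p) i (_ , q) → ψ-∘ i (Dias⊆image p) (Dias⊆image q) }
    }

theorem2p2p6 : ∀ {c ℓ₁ ℓ₂} (𝕂 : HeytingField c ℓ₁ ℓ₂) → CharacteristicZero 𝕂 →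
    let open Diassociative 𝕂 in
    ∀ (γ : ℕ) → AdmitsPresentation (Dias γ) (𝔊 γ) (RelationSpace γ)
theorem2p2p6 𝕂 _ γ = Isomorphism.Dias≅Q 𝕂 γ
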